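{- Let $\mathbb F$ be any field, $n\ge k\ge 1$, and let $\mathcal K\subseteq M_{n\times k}(\mathbb F)$ be a linear variety such that $\det_{n,k}(X)=0$ for every $X\in\mathcal K$. Then $\operatorname{codim}(\mathcal K)\ge k$.
   Context: A linear variety in a finite-dimensional space $W$ is a nonempty set of the form $\mathbf s+V$ with $V\subseteq W$ a linear subspace (uniquely determined); $\operatorname{codim}\mathcal K=\dim W-\dim V$, here $W=M_{n\times k}(\mathbb F)$. Cullis' determinant: for $n\ge k$ and $X\in M_{n\times k}(\mathbb F)$, $\det_{n,k}(X)=\sum_{c}\operatorname{sgn}(c)\det\big(X[c|)\big)$, where $c$ ranges over the $k$-element subsets of $[n]$, $X[c|)$ is the $k\times k$ submatrix formed by the rows indexed by $c$ (in increasing order), and for $c=\{c(1)<\dots<c(k)\}$, $\operatorname{sgn}(c)=(-1)^{\sum_{\alpha=1}^k (c(\alpha)-\alpha)}$. -}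

module Defs where

open import Algebra.Apartness.Bundles using (HeytingField; HeytingCommutativeRing)
open import Algebra.Bundles using (CommutativeRing; Semiring)
import Algebra.Definitions.RawMonoid as RawMonoidDefs
import Algebra.Definitions.RawSemiring as RawSemiringDefs
open import Algebra.Module.Bundles using (Module)
import Algebra.Module.Construct.TensorUnit as TensorUnit
open import Data.Fin.Base using (Fin; zero; suc; toℕ; punchIn)
open import Data.Fin.Subset using (Subset; inside; outside; ∣_∣)
open import Data.List.Base using (List; []; _∷_; _++_; map; foldr)
open import Data.Nat.Base using (ℕ; zero; suc; _∸_; +-0-rawMonoid)
open import Data.Product.Base using (Σ; ∃; ∃₂; _×_; _,_)
open import Data.Vec.Base using ([]; _∷_)
open import Data.Vec.Functional using (Vector)
open import Function.Bundles using (_⇔_)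
open import Level using (Level; _⊔_) renaming (suc to lsuc)
open import Relation.Binary.PropositionalEquality.Core using (_≡_; refl; cong)
open import Relation.Unary using (Pred; _∈_; U)

commutativeRing : ∀ {c ℓ₁ ℓ₂} → HeytingField c ℓ₁ ℓ₂ → CommutativeRing c ℓ₁
commutativeRing F =
  HeytingCommutativeRing.commutativeRing (HeytingField.heytingCommutativeRing F)

-- The direct power W^n with componentwise operations.
power : ∀ {r ℓr m ℓm} {R : CommutativeRing r ℓr} → ℕ → Module R m ℓm → Module R m ℓm
power n W = record
  { Carrierᴹ = Vector Carrierᴹ n
  ; _≈ᴹ_     = λ u v → ∀ i → u i ≈ᴹ v i
  ; _+ᴹ_     = λ u v i → u i +ᴹ v i
  ; _*ₗ_     = λ a v i → a *ₗ v i
  ; _*ᵣ_     = λ v a i → v i *ᵣ a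
  ; 0ᴹ       = λ _ → 0ᴹ
  ; -ᴹ_      = λ v i → -ᴹ v i
  ; isModule = record
    { isBimodule = record
      { isBisemimodule = record
        { +ᴹ-isCommutativeMonoid = record
          { isMonoid = record
            { isSemigroup = record
              { isMagma = record
                { isEquivalence = record
                  { refl  = λ _ → ≈ᴹ-refl
                  ; sym   = λ p i → ≈ᴹ-sym (p i)
                  ; trans = λ p q i → ≈ᴹ-trans (p i) (q i)
                  }
                ; ∙-cong = λ p q i → +ᴹ-cong (p i) (q i)
                }
              ; assoc = λ u v w i → +ᴹ-assoc (u i) (v i) (w i)
              }
            ; identity = (λ v i → +ᴹ-identityˡ (v i)) , (λ v i → +ᴹ-identityʳ (v i))
            }
          ; comm = λ u v i → +ᴹ-comm (u i) (v i)
          }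
        ; isPreleftSemimodule = record
          { *ₗ-cong      = λ p q i → *ₗ-cong p (q i)
          ; *ₗ-zeroˡ     = λ v i → *ₗ-zeroˡ (v i)
          ; *ₗ-distribʳ  = λ v a b i → *ₗ-distribʳ (v i) a b
          ; *ₗ-identityˡ = λ v i → *ₗ-identityˡ (v i)
          ; *ₗ-assoc     = λ a b v i → *ₗ-assoc a b (v i)
          ; *ₗ-zeroʳ     = λ a i → *ₗ-zeroʳ a
          ; *ₗ-distribˡ  = λ a u v i → *ₗ-distribˡ a (u i) (v i)
          }
        ; isPrerightSemimodule = record
          { *ᵣ-cong      = λ p q i → *ᵣ-cong (p i) q
          ; *ᵣ-zeroʳ     = λ v i → *ᵣ-zeroʳ (v i)
          ; *ᵣ-distribˡ  = λ v a b i → *ᵣ-distribˡ (v i) a b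
          ; *ᵣ-identityʳ = λ v i → *ᵣ-identityʳ (v i)
          ; *ᵣ-assoc     = λ v a b i → *ᵣ-assoc (v i) a b
          ; *ᵣ-zeroˡ     = λ a i → *ᵣ-zeroˡ a
          ; *ᵣ-distribʳ  = λ a u v i → *ᵣ-distribʳ a (u i) (v i)
          }
        ; *ₗ-*ᵣ-assoc = λ a v b i → *ₗ-*ᵣ-assoc a (v i) b
        }
      ; -ᴹ‿cong    = λ p i → -ᴹ‿cong (p i)
      ; -ᴹ‿inverse = (λ v i → -ᴹ‿inverseˡ (v i)) , (λ v i → -ᴹ‿inverseʳ (v i))
      }
    ; *ₗ-*ᵣ-coincident = λ a v i → *ₗ-*ᵣ-coincident a (v i)
    }
  }
  where open Module W

module _ {r ℓr m ℓm : Level} {R : CommutativeRing r ℓr} (W : Module R m ℓm) where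

  open CommutativeRing R using (Carrier; _≈_; 0#)
  open Module W
  private module Sumᴹ = RawMonoidDefs +ᴹ-rawMonoid

  record IsSubspace {p} (V : Pred Carrierᴹ p) : Set (r ⊔ m ⊔ ℓm ⊔ p) where
    field
      resp      : ∀ {u v} → u ≈ᴹ v → u ∈ V → v ∈ V
      0-closed  : 0ᴹ ∈ V
      +-closed  : ∀ {u v} → u ∈ V → v ∈ V → u +ᴹ v ∈ V
      *ₗ-closed : ∀ a {v} → v ∈ V → a *ₗ v ∈ V

  combination : ∀ {d} → Vector Carrier d → Vector Carrierᴹ d → Carrierᴹ
  combination a b = Sumᴹ.sum (λ i → a i *ₗ b i)

  record IsBasis {p d} (V : Pred Carrierᴹ p) (b : Vector Carrierᴹ d)
                 : Set (r ⊔ ℓr ⊔ m ⊔ ℓm ⊔ p) where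
    field
      members     : ∀ i → b i ∈ V
      independent : ∀ a → combination a b ≈ᴹ 0ᴹ → ∀ i → a i ≈ 0#
      spanning    : ∀ {v} → v ∈ V → ∃ λ a → v ≈ᴹ combination a b

  HasDim : ∀ {p} → Pred Carrierᴹ p → ℕ → Set (r ⊔ ℓr ⊔ m ⊔ ℓm ⊔ p)
  HasDim V d = Σ (Vector Carrierᴹ d) (IsBasis V)

  record IsLinearVariety {q} p (K : Pred Carrierᴹ q) : Set (r ⊔ m ⊔ ℓm ⊔ q ⊔ lsuc p) where
    field
      point      : Carrierᴹ
      direction  : Pred Carrierᴹ p
      isSubspace : IsSubspace direction
      translate  : ∀ x → x ∈ K ⇔ (∃ λ v → v ∈ direction × x ≈ᴹ point +ᴹ v)

  -- A relation rather than a function, since constructively a subspace need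
  -- not come with a basis.
  HasCodim : ∀ {p q} {K : Pred Carrierᴹ q} → IsLinearVariety p K → ℕ →
             Set (r ⊔ ℓr ⊔ m ⊔ ℓm ⊔ p)
  HasCodim K-variety e =
    ∃₂ λ dimW dimV → HasDim (U {A = Carrierᴹ}) dimW × HasDim direction dimV × e ≡ dimW ∸ dimV
    where open IsLinearVariety K-variety

KSubset : ℕ → ℕ → Set
KSubset n k = Σ (Subset n) λ p → ∣ p ∣ ≡ k

kSubsets : ∀ n k → List (KSubset n k)
kSubsets zero    zero    = ([] , refl) ∷ []
kSubsets zero    (suc k) = []
kSubsets (suc n) zero    = map (λ (p , eq) → outside ∷ p , eq) (kSubsets n zero)
kSubsets (suc n) (suc k) =
  map (λ (p , eq) → inside ∷ p , cong suc eq) (kSubsets n k) ++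
  map (λ (p , eq) → outside ∷ p , eq) (kSubsets n (suc k))

-- The elements of a subset in increasing order.
elements : ∀ {n} (p : Subset n) → Fin ∣ p ∣ → Fin n
elements (inside  ∷ p) zero    = zero
elements (inside  ∷ p) (suc i) = suc (elements p i)
elements (outside ∷ p) i       = suc (elements p i)

element : ∀ {n k} → KSubset n k → Fin k → Fin n
element (p , refl) = elements p

-- Σ_α (c(α) − α); both indices are 0-based here, which leaves the difference
-- unchanged, and toℕ (c(α)) ≥ toℕ α, so the subtraction never truncates.
shift : ∀ {n k} → KSubset n k → ℕ
shift c = RawMonoidDefs.sum +-0-rawMonoid (λ α → toℕ (element c α) ∸ toℕ α)

module _ {r ℓr : Level} (R : CommutativeRing r ℓr) where

  open CommutativeRing R using (Carrier; _+_; _*_; -_; 0#; 1#; semiring)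
  open RawSemiringDefs (Semiring.rawSemiring semiring) using (sum; _^_)

  matrixSpace : ℕ → ℕ → Module R r ℓr
  matrixSpace n k = power n (power k TensorUnit.⟨module⟩)

  Matrix : ℕ → ℕ → Set r
  Matrix n k = Vector (Vector Carrier k) n

  -- Laplace expansion along the first column.
  det : ∀ {k} → Matrix k k → Carrier
  det {zero}  X = 1#
  det {suc k} X =
    sum (λ i → (- 1#) ^ toℕ i * (X i zero * det (λ a b → X (punchIn i a) (suc b))))

  cullisDet : ∀ {n k} → Matrix n k → Carrier
  cullisDet {n} {k} X =
    foldr _+_ 0# (map (λ c → (- 1#) ^ shift c * det (λ α → X (element c α))) (kSubsets n k))

{-# OPTIONS --safe #-}
module Submission where

-- Cullis' determinant is alternating and multilinear in the columns, and any nonzero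
-- alternating k-form ω on F^n has the property claimed.  Write K = s + V and fix a vector e
-- with ω(e, …) ≠ 0; we look for k matrices independent modulo V.  If e ⊗ v ∈ V for no v ≠ 0,
-- the matrices e ⊗ unit i will do.  Otherwise change the basis of F^k so that v becomes a unit
-- vector: moving along e ⊗ v shows that ω(e, …) vanishes on K with that column removed, even
-- after adding e ⊗ F^k to V, and induction yields k − 1 independent matrices.  A further one is
-- any matrix outside V that became zero; if there is none, then V contains e ⊗ F^k, hence
-- (repeating the argument for every v) all columns, so V is everything and ω = 0.
--
-- Equality in a Heyting field is stable but not decidable, and k ≤ codim is decidable, so the
-- case distinctions are made under double negation.

open import Defs
open import Algebra.Apartness.Bundles using (HeytingField)
open import Algebra.Bundles using (CommutativeRing)
open import Data.Fin.Base using (Fin; zero; suc; toℕ; punchIn; punchOut; _↑ˡ_; _↑ʳ_)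
open import Data.Fin.Properties using (_≟_; punchIn-punchOut; punchIn-injective; punchInᵢ≢i; suc-injective)
open import Data.Fin.Subset using (inside; outside; ∣_∣)
open import Data.List.Base as List using (List)
open import Data.List.Properties using (map-++)
open import Data.Nat.Base as ℕ using (ℕ; zero; suc; _≤_; z≤n; s≤s)
open import Data.Nat.Properties using (_≤?_; m≤n⇒m≤1+n; m+n≤o⇒m≤o∸n)
open import Data.Product.Base using (∃; ∃₂; _×_; _,_; proj₁; proj₂)
import Data.Vec.Base as Vec
open import Data.Vec.Functional using (Vector; []; _∷_; _++_; insertAt; updateAt)
open import Data.Vec.Functional.Properties
  using (insertAt-lookup; insertAt-punchIn; updateAt-updates; updateAt-minimal; lookup-++ˡ; lookup-++ʳ)
open import Function.Base using (_∘_; const)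
open import Function.Bundles using (Equivalence)
open import Level using (_⊔_)
open import Relation.Binary.PropositionalEquality.Core as ≡ using (_≡_; _≢_)
open import Relation.Nullary.Decidable.Core using (yes; no; decidable-stable)
open import Relation.Nullary.Negation.Core using (¬_; contradiction)
open import Relation.Unary using (Pred; _∈_; U)

-- Replacing the entries of a vector one at a time.

punchIn-elim : ∀ {p k} (P : Fin (suc k) → Set p) j → P j → (∀ b → P (punchIn j b)) → ∀ b → P b
punchIn-elim P j Pj Pin b with j ≟ b
... | yes ≡.refl = Pj
... | no j≢b = ≡.subst P (punchIn-punchOut j≢b) (Pin (punchOut j≢b))

-- The vector u is turned into v from index zero upwards, each intermediate vector differing from
-- the one before in a single entry. `resp` stands in for function extensionality: vectors are
-- functions, and the vectors built on the way agree with the intended ones only pointwise.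
change-coordinates : ∀ {a p k} {A : Set a} (P : Vector A k → Set p) →
  (∀ {u v} → (∀ b → u b ≡ v b) → P u → P v) →
  (∀ i {u v} → (∀ b → b ≢ i → u b ≡ v b) → P u → P v) →
  ∀ u v → P u → P v
change-coordinates {k = zero}  P resp step u v Pu = resp (λ ()) Pu
change-coordinates {k = suc k} P resp step u v Pu =
  resp (λ { zero → ≡.refl ; (suc b) → ≡.refl })
    (change-coordinates (λ w → P (v zero ∷ w))
      (λ eq → resp λ { zero → ≡.refl ; (suc b) → eq b })
      (λ i eq → step (suc i) λ { zero _ → ≡.refl ; (suc b) b≢i → eq b (b≢i ∘ ≡.cong suc) })
      (u ∘ suc) (v ∘ suc)
      (step zero (λ { zero 0≢0 → contradiction ≡.refl 0≢0 ; (suc b) _ → ≡.refl }) Pu))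

-- Alternating multilinear forms in the columns of a matrix.

module AlternatingForms {c ℓ} (R : CommutativeRing c ℓ) where

  open CommutativeRing R hiding (zero)
  open import Algebra.Properties.Semiring.Sum semiring
    using (sum; sum-cong-≋; sum-replicate-zero; ∑-distrib-+; ∑-comm; *-distribˡ-sum)
  open import Algebra.Properties.Semiring.Exp semiring using (_^_)
  open import Algebra.Solver.Ring.NaturalCoefficients.Default commutativeSemiring
    using (solve; _:+_; _:*_; _:=_; con)
  open import Relation.Binary.Reasoning.Setoid setoid

  infix 4 _≋_
  _≋_ : ∀ {n k} → Matrix R n k → Matrix R n k → Set ℓ
  X ≋ Y = ∀ a b → X a b ≈ Y a b

  -- Three matrices are compared entry by entry, instead of being built by replacing column j, so
  -- that the rule applies to matrices however they are written, in particular to minors and row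
  -- selections.
  record IsMultilinear {n k} (ω : Matrix R n k → Carrier) : Set (c ⊔ ℓ) where
    field
      ω-cong : ∀ {X Y} → X ≋ Y → ω X ≈ ω Y
      linear : ∀ j s t {X Y Z} → (∀ a → X a j ≈ s * Y a j + t * Z a j) →
               (∀ a b → b ≢ j → X a b ≈ Y a b) → (∀ a b → b ≢ j → X a b ≈ Z a b) →
               ω X ≈ s * ω Y + t * ω Z

    additive : ∀ j {X Y Z} → (∀ a → X a j ≈ Y a j + Z a j) →
               (∀ a b → b ≢ j → X a b ≈ Y a b) → (∀ a b → b ≢ j → X a b ≈ Z a b) →
               ω X ≈ ω Y + ω Z
    additive j eq offY offZ =
      trans (linear j 1# 1# (λ a → trans (eq a) (sym (1*+1* _ _))) offY offZ) (1*+1* _ _)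
      where
      1*+1* : ∀ x y → 1# * x + 1# * y ≈ x + y
      1*+1* x y = +-cong (*-identityˡ x) (*-identityˡ y)

  -- Alternation means vanishing on a repeated column; a change of sign under exchange would be
  -- weaker in characteristic 2.
  record IsAlternating {n k} (ω : Matrix R n k → Carrier) : Set (c ⊔ ℓ) where
    field
      isMultilinear : IsMultilinear ω
      alternating   : ∀ {i j} → i ≢ j → ∀ {X} → (∀ a → X a i ≈ X a j) → ω X ≈ 0#

    open IsMultilinear isMultilinear public

  setCol : ∀ {n k} → Matrix R n k → Fin k → Vector Carrier n → Matrix R n k
  setCol X j x a = updateAt (X a) j (const (x a))

  module _ {n k} (X : Matrix R n k) (j : Fin k) (x : Vector Carrier n) where

    setCol-at : ∀ a → setCol X j x a j ≈ x a
    setCol-at a = reflexive (updateAt-updates j (X a))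

    setCol-off : ∀ a b → b ≢ j → setCol X j x a b ≈ X a b
    setCol-off a b b≢j = reflexive (updateAt-minimal b j (X a) b≢j)

  module _ {n k} {ω : Matrix R n k → Carrier} (ml : IsMultilinear ω)
           {i j} (i≢j : i ≢ j) (vanish : ∀ {X} → (∀ a → X a i ≈ X a j) → ω X ≈ 0#) where

    open IsMultilinear ml

    -- With x and y the columns i and j of X, expand the value at x + y in both places, which
    -- vanishes. The two terms with a repeated column vanish too, and the mixed ones remain.
    -- Vanishing is assumed for the pair i, j alone, so that the lemma is available while `det` is
    -- still being proved alternating.
    exchange-columns : ∀ {X Y} → (∀ a → Y a i ≈ X a j) → (∀ a → Y a j ≈ X a i) →
                       (∀ a b → b ≢ i → b ≢ j → Y a b ≈ X a b) → ω X + ω Y ≈ 0#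
    exchange-columns {X} {Y} Yi Yj Y-off = begin
      ω X + ω Y
        ≈⟨ +-cong (ω-cong (M-unique (λ _ → refl) (λ _ → refl) λ _ _ _ _ → refl))
                  (ω-cong (M-unique Yi Yj Y-off)) ⟩
      ω (M x y) + ω (M y x)
        ≈⟨ +-cong (+-identityˡ _) (+-identityʳ _) ⟨
      (0# + ω (M x y)) + (ω (M y x) + 0#)
        ≈⟨ +-cong (+-congʳ (M-diagonal x)) (+-congˡ (M-diagonal y)) ⟨
      (ω (M x x) + ω (M x y)) + (ω (M y x) + ω (M y y))
        ≈⟨ +-cong (M-additiveʳ x) (M-additiveʳ y) ⟨
      ω (M x x+y) + ω (M y x+y)
        ≈⟨ M-additiveˡ ⟨
      ω (M x+y x+y)
        ≈⟨ M-diagonal x+y ⟩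
      0# ∎
      where
      x y x+y : Vector Carrier n
      x a = X a i
      y a = X a j
      x+y a = x a + y a

      M : Vector Carrier n → Vector Carrier n → Matrix R n k
      M p q = setCol (setCol X i p) j q

      M-i : ∀ p q a → M p q a i ≈ p a
      M-i p q a = trans (setCol-off (setCol X i p) j q a i i≢j) (setCol-at X i p a)

      M-j : ∀ p q a → M p q a j ≈ q a
      M-j p q = setCol-at (setCol X i p) j q

      M-off : ∀ p q a b → b ≢ i → b ≢ j → M p q a b ≈ X a b
      M-off p q a b b≢i b≢j = trans (setCol-off (setCol X i p) j q a b b≢j) (setCol-off X i p a b b≢i)

      M-unique : ∀ {Z p q} → (∀ a → Z a i ≈ p a) → (∀ a → Z a j ≈ q a) →
                 (∀ a b → b ≢ i → b ≢ j → Z a b ≈ X a b) → Z ≋ M p q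
      M-unique {Z} {p} {q} Zi Zj Z-off a b with b ≟ i | b ≟ j
      ... | yes ≡.refl | _          = trans (Zi a) (sym (M-i p q a))
      ... | no _       | yes ≡.refl = trans (Zj a) (sym (M-j p q a))
      ... | no b≢i     | no b≢j     = trans (Z-off a b b≢i b≢j) (sym (M-off p q a b b≢i b≢j))

      M-off-i : ∀ p p′ q a b → b ≢ i → M p q a b ≈ M p′ q a b
      M-off-i p p′ q a b b≢i with b ≟ j
      ... | yes ≡.refl = trans (M-j p q a) (sym (M-j p′ q a))
      ... | no b≢j     = trans (M-off p q a b b≢i b≢j) (sym (M-off p′ q a b b≢i b≢j))

      M-off-j : ∀ p q q′ a b → b ≢ j → M p q a b ≈ M p q′ a b
      M-off-j p q q′ a b b≢j =
        trans (setCol-off (setCol X i p) j q a b b≢j) (sym (setCol-off (setCol X i p) j q′ a b b≢j))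

      M-diagonal : ∀ p → ω (M p p) ≈ 0#
      M-diagonal p = vanish λ a → trans (M-i p p a) (sym (M-j p p a))

      M-additiveˡ : ω (M x+y x+y) ≈ ω (M x x+y) + ω (M y x+y)
      M-additiveˡ = additive i
        (λ a → trans (M-i x+y x+y a) (sym (+-cong (M-i x x+y a) (M-i y x+y a))))
        (M-off-i x+y x x+y) (M-off-i x+y y x+y)

      M-additiveʳ : ∀ p → ω (M p x+y) ≈ ω (M p x) + ω (M p y)
      M-additiveʳ p = additive j
        (λ a → trans (M-j p x+y a) (sym (+-cong (M-j p x a) (M-j p y a))))
        (M-off-j p x+y x) (M-off-j p x+y y)

  -- Inserting a column

  insertCol : ∀ {n k} → Matrix R n k → Fin (suc k) → Vector Carrier n → Matrix R n (suc k)
  insertCol Y j x a = insertAt (Y a) j (x a)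

  module _ {n k} (Y : Matrix R n k) (j : Fin (suc k)) (x : Vector Carrier n) where

    insertCol-at : ∀ a → insertCol Y j x a j ≈ x a
    insertCol-at a = reflexive (insertAt-lookup (Y a) j (x a))

    insertCol-in : ∀ a b → insertCol Y j x a (punchIn j b) ≈ Y a b
    insertCol-in a b = reflexive (insertAt-punchIn (Y a) j (x a) b)

    insertCol-unique : ∀ {Z} → (∀ a → Z a j ≈ x a) → (∀ a b → Z a (punchIn j b) ≈ Y a b) →
                       Z ≋ insertCol Y j x
    insertCol-unique Zj Zin a = punchIn-elim _ j
      (trans (Zj a) (sym (insertCol-at a))) (λ b → trans (Zin a b) (sym (insertCol-in a b)))

  insertCol-cong : ∀ {n k} {X Y : Matrix R n k} j {x y : Vector Carrier n} →
                   X ≋ Y → (∀ a → x a ≈ y a) → insertCol X j x ≋ insertCol Y j y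
  insertCol-cong {X = X} {Y} j {x} {y} X≋Y x≈y = insertCol-unique Y j y
    (λ a → trans (insertCol-at X j x a) (x≈y a)) (λ a b → trans (insertCol-in X j x a b) (X≋Y a b))

  insertCol-off : ∀ {n k} {X Y : Matrix R n k} j x i →
                  (∀ a b → b ≢ i → X a b ≈ Y a b) →
                  ∀ a b → b ≢ punchIn j i → insertCol X j x a b ≈ insertCol Y j x a b
  insertCol-off {X = X} {Y} j x i off a = punchIn-elim _ j
    (λ _ → trans (insertCol-at X j x a) (sym (insertCol-at Y j x a)))
    (λ b b≢i → trans (insertCol-in X j x a b)
      (trans (off a b (b≢i ∘ ≡.cong (punchIn j))) (sym (insertCol-in Y j x a b))))

  module _ {n k} {ω : Matrix R n (suc k) → Carrier} (alt : IsAlternating ω) (j : Fin (suc k)) where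

    open IsAlternating alt

    -- The contraction of ω with e in slot j: a form in one column fewer, to which the induction
    -- applies.
    insertCol-isAlternating : ∀ e → IsAlternating (λ Y → ω (insertCol Y j e))
    insertCol-isAlternating e = record
      { isMultilinear = record
        { ω-cong = λ X≋Y → ω-cong (insertCol-cong j X≋Y (λ _ → refl))
        ; linear = λ i s t {X} {Y} {Z} eq offY offZ → linear (punchIn j i) s t
            (λ a → trans (insertCol-in X j e a i) (trans (eq a)
              (sym (+-cong (*-congˡ (insertCol-in Y j e a i)) (*-congˡ (insertCol-in Z j e a i))))))
            (insertCol-off j e i offY) (insertCol-off j e i offZ)
        }
      ; alternating = λ {i} {i′} i≢i′ {X} eq → alternating (i≢i′ ∘ punchIn-injective j i i′)
          (λ a → trans (insertCol-in X j e a i) (trans (eq a) (sym (insertCol-in X j e a i′))))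
      }

    -- The entries of u are switched on one at a time, starting from zero. Changing entry i adds a
    -- multiple of the column x to another column, hence, by linearity, a multiple of a value of ω
    -- with x in two columns.
    shear-invariant : ∀ (Y : Matrix R n k) x u →
      ω (insertCol (λ a b → Y a b + x a * u b) j x) ≈ ω (insertCol Y j x)
    shear-invariant Y x u = change-coordinates P
      (λ {v} {w} eq → trans (ω-cong (insertCol-cong {X = sheared w} {Y = sheared v} j
        (λ a b → +-congˡ (*-congˡ (reflexive (≡.sym (eq b))))) λ _ → refl)))
      (λ i {v} {w} eq Pv → trans (step i v w eq) Pv)
      (const 0#) u
      (ω-cong (insertCol-cong j (λ a b → trans (+-congˡ (zeroʳ (x a))) (+-identityʳ _)) (λ _ → refl)))
      where
      sheared : Vector Carrier k → Matrix R n k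
      sheared v a b = Y a b + x a * v b

      P : Vector Carrier k → Set ℓ
      P v = ω (insertCol (sheared v) j x) ≈ ω (insertCol Y j x)

      module _ (i : Fin k) (v w : Vector Carrier k) (v≡w : ∀ b → b ≢ i → v b ≡ w b) where

        T : Matrix R n (suc k)
        T = setCol (insertCol (sheared v) j x) (punchIn j i) x

        ωT≈0 : ω T ≈ 0#
        ωT≈0 = alternating (punchInᵢ≢i j i ∘ ≡.sym) λ a →
          trans (setCol-off (insertCol (sheared v) j x) (punchIn j i) x a j (punchInᵢ≢i j i ∘ ≡.sym))
            (trans (insertCol-at (sheared v) j x a)
              (sym (setCol-at (insertCol (sheared v) j x) (punchIn j i) x a)))

        off : ∀ a b → b ≢ punchIn j i → insertCol (sheared w) j x a b ≈ insertCol (sheared v) j x a b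
        off = insertCol-off j x i λ a b b≢i → +-congˡ (*-congˡ (reflexive (≡.sym (v≡w b b≢i))))

        -- The new column as a combination of the old one and x, in the shape that `linear` asks
        -- for.
        entry : ∀ y x v w → y + x * w ≈ 1# * (y + x * v) + (w - v) * x
        entry y x v w = begin
          y + x * w                             ≈⟨ +-identityʳ _ ⟨
          y + x * w + 0#                        ≈⟨ +-congˡ (trans (*-congˡ (-‿inverseʳ v)) (zeroʳ x)) ⟨
          y + x * w + x * (v - v)
            ≈⟨ solve 5 (λ y x v w v′ → y :+ x :* w :+ x :* (v :+ v′)
                 := con 1 :* (y :+ x :* v) :+ (w :+ v′) :* x) refl y x v w (- v) ⟩
          1# * (y + x * v) + (w - v) * x        ∎

        step : ω (insertCol (sheared w) j x) ≈ ω (insertCol (sheared v) j x)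
        step = begin
          ω (insertCol (sheared w) j x)
            ≈⟨ linear (punchIn j i) 1# (w i - v i)
                 (λ a → trans (insertCol-in (sheared w) j x a i) (trans (entry _ _ _ _)
                   (sym (+-cong (*-congˡ (insertCol-in (sheared v) j x a i))
                                (*-congˡ (setCol-at (insertCol (sheared v) j x) (punchIn j i) x a))))))
                 off
                 (λ a b b≢ → trans (off a b b≢) (sym (setCol-off (insertCol (sheared v) j x) (punchIn j i) x a b b≢))) ⟩
          1# * ω (insertCol (sheared v) j x) + (w i - v i) * ω T
            ≈⟨ +-cong (*-identityˡ _) (trans (*-congˡ ωT≈0) (zeroʳ _)) ⟩
          ω (insertCol (sheared v) j x) + 0#  ≈⟨ +-identityʳ _ ⟩
          ω (insertCol (sheared v) j x)       ∎

    -- Exchanging columns i and j carries e from slot i to slot j at the cost of a sign. Read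
    -- contrapositively: if e is a column of a matrix at which ω does not vanish, then the
    -- contraction with e is not identically zero, whichever slot is used.
    vanishes-at-every-slot : ∀ e → (∀ Y → ω (insertCol Y j e) ≈ 0#) →
                             ∀ i X → (∀ a → X a i ≈ e a) → ω X ≈ 0#
    vanishes-at-every-slot e vanish i X Xi with i ≟ j
    ... | yes ≡.refl = trans
      (ω-cong (insertCol-unique (λ a b → X a (punchIn j b)) j e Xi (λ _ _ → refl))) (vanish _)
    ... | no i≢j = begin
      ω X        ≈⟨ +-identityʳ _ ⟨
      ω X + 0#   ≈⟨ +-congˡ ωX′≈0 ⟨
      ω X + ω X′ ≈⟨ exchange-columns isMultilinear i≢j (alternating i≢j)
                      (λ a → trans (setCol-off X₁ j e a i i≢j) (setCol-at X i xⱼ a))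
                      (λ a → trans (setCol-at X₁ j e a) (sym (Xi a)))
                      (λ a b b≢i b≢j → trans (setCol-off X₁ j e a b b≢j) (setCol-off X i xⱼ a b b≢i)) ⟩
      0#         ∎
      where
      xⱼ : Vector Carrier n
      xⱼ a = X a j

      X₁ X′ : Matrix R n (suc k)
      X₁ = setCol X i xⱼ
      X′ = setCol X₁ j e

      ωX′≈0 : ω X′ ≈ 0#
      ωX′≈0 = trans (ω-cong (insertCol-unique (λ a b → X′ a (punchIn j b)) j e
                (setCol-at X₁ j e) (λ _ _ → refl))) (vanish _)

  -- Determinants

  sum-cong : ∀ {m} (f g : Vector Carrier m) → (∀ i → f i ≈ g i) → sum f ≈ sum g
  sum-cong {m} f g f≈g = sum-cong-≋ {m} {f} {g} f≈g

  sum-zero : ∀ {m} (f : Vector Carrier m) → (∀ i → f i ≈ 0#) → sum f ≈ 0#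
  sum-zero {m} f f≈0 = trans (sum-cong f (const 0#) f≈0) (sum-replicate-zero m)

  sum-linear : ∀ {m} s t (f g : Vector Carrier m) →
               sum (λ i → s * f i + t * g i) ≈ s * sum f + t * sum g
  sum-linear s t f g = trans (∑-distrib-+ (λ i → s * f i) (λ i → t * g i))
    (sym (+-cong (*-distribˡ-sum s f) (*-distribˡ-sum t g)))

  sgn : ℕ → Carrier
  sgn m = (- 1#) ^ m

  minor : ∀ {k} → Matrix R (suc k) (suc k) → Fin (suc k) → Matrix R k k
  minor X i a b = X (punchIn i a) (suc b)

  laplaceTerm : ∀ {k} → Matrix R (suc k) (suc k) → Fin (suc k) → Carrier
  laplaceTerm X i = sgn (toℕ i) * (X i zero * det R (minor X i))

  det-cong : ∀ {k} {X Y : Matrix R k k} → X ≋ Y → det R X ≈ det R Y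
  det-cong {zero}  X≋Y = refl
  det-cong {suc k} {X} {Y} X≋Y = sum-cong (laplaceTerm X) (laplaceTerm Y) λ i → *-congˡ {sgn (toℕ i)}
    (*-cong (X≋Y i zero) (det-cong λ a b → X≋Y (punchIn i a) (suc b)))

  det-isMultilinear : ∀ {k} → IsMultilinear (det R {k})
  det-isMultilinear = record { ω-cong = det-cong ; linear = det-linear }
    where
    -- For column zero the entries vary while the minors agree; for a later column the entries agree
    -- and the minors vary linearly by induction.
    det-linear : ∀ {k} (j : Fin k) s t {X Y Z : Matrix R k k} →
      (∀ a → X a j ≈ s * Y a j + t * Z a j) →
      (∀ a b → b ≢ j → X a b ≈ Y a b) → (∀ a b → b ≢ j → X a b ≈ Z a b) →
      det R X ≈ s * det R Y + t * det R Z
    det-linear zero s t {X} {Y} {Z} eq offY offZ = trans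
      (sum-cong (laplaceTerm X) (λ i → s * laplaceTerm Y i + t * laplaceTerm Z i) λ i →
        trans (*-congˡ {sgn (toℕ i)} (trans (*-congʳ (eq i)) (trans (distribʳ _ _ _) (+-cong
          (*-congˡ (det-cong λ a b → offY (punchIn i a) (suc b) λ ()))
          (*-congˡ (det-cong λ a b → offZ (punchIn i a) (suc b) λ ()))))))
        (solve 7 (λ g s t y z d d′ → g :* (s :* y :* d :+ t :* z :* d′)
            := s :* (g :* (y :* d)) :+ t :* (g :* (z :* d′))) refl
          (sgn (toℕ i)) s t (Y i zero) (Z i zero) (det R (minor Y i)) (det R (minor Z i))))
      (sum-linear s t (laplaceTerm Y) (laplaceTerm Z))
    det-linear (suc j) s t {X} {Y} {Z} eq offY offZ = trans
      (sum-cong (laplaceTerm X) (λ i → s * laplaceTerm Y i + t * laplaceTerm Z i) λ i →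
        trans (*-congˡ {sgn (toℕ i)} (trans (*-congˡ (det-linear j s t
            (λ a → eq (punchIn i a))
            (λ a b b≢j → offY (punchIn i a) (suc b) (b≢j ∘ suc-injective))
            (λ a b b≢j → offZ (punchIn i a) (suc b) (b≢j ∘ suc-injective))))
          (trans (distribˡ _ _ _) (+-cong
            (trans (sym (*-assoc _ _ _)) (*-congʳ (*-congʳ (offY i zero λ ()))))
            (trans (sym (*-assoc _ _ _)) (*-congʳ (*-congʳ (offZ i zero λ ()))))))))
        (solve 7 (λ g s t y z d d′ → g :* (y :* s :* d :+ z :* t :* d′)
            := s :* (g :* (y :* d)) :+ t :* (g :* (z :* d′))) refl
          (sgn (toℕ i)) s t (Y i zero) (Z i zero) (det R (minor Y i)) (det R (minor Z i))))
      (sum-linear s t (laplaceTerm Y) (laplaceTerm Z))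

  -- The head terms of the row and column expansions coincide. The other minors of the column
  -- expansion still contain the top row; expanding them along it, by induction, gives a double sum,
  -- and the row expansion gives the same sum in the other order.
  det-expand-row : ∀ {k} (X : Matrix R (suc k) (suc k)) →
    det R X ≈ sum (λ j → sgn (toℕ j) * (X zero j * det R (λ a b → X (suc a) (punchIn j b))))
  det-expand-row {zero}  X = refl
  det-expand-row {suc k} X = +-congˡ (begin
    sum (λ i → laplaceTerm X (suc i))
      ≈⟨ sum-cong (λ i → laplaceTerm X (suc i)) (λ i → sum (columnFirst i)) (λ i →
           distribute (toℕ i) (X (suc i) zero)
             (λ j → sgn (toℕ j) * (X zero (suc j) * D i j)) (det-expand-row (minor X (suc i)))) ⟩
    sum (λ i → sum (columnFirst i))
      ≈⟨ ∑-comm columnFirst ⟩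
    sum (λ j → sum (λ i → columnFirst i j))
      ≈⟨ sum-cong (λ j → sum (λ i → columnFirst i j)) (λ j → sum (rowFirst j)) (λ j →
           sum-cong (λ i → columnFirst i j) (rowFirst j) (λ i →
             solve 6 (λ m g x h y d → (m :* g) :* (x :* (h :* (y :* d)))
               := (m :* h) :* (y :* (g :* (x :* d)))) refl
               (- 1#) (sgn (toℕ i)) (X (suc i) zero) (sgn (toℕ j)) (X zero (suc j)) (D i j))) ⟩
    sum (λ j → sum (rowFirst j))
      ≈⟨ sum-cong expanded (λ j → sum (rowFirst j)) (λ j →
           -- These minors still contain the first column, along which `det` expands by definition,
           -- hence `refl`.
           distribute (toℕ j) (X zero (suc j))
             (λ i → sgn (toℕ i) * (X (suc i) zero * D i j)) refl) ⟨
    sum expanded ∎)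
    where
    D : Fin (suc k) → Fin (suc k) → Carrier
    D i j = det R (λ a b → X (suc (punchIn i a)) (suc (punchIn j b)))

    columnFirst rowFirst : Fin (suc k) → Vector Carrier (suc k)
    columnFirst i j = sgn (suc (toℕ i)) * (X (suc i) zero * (sgn (toℕ j) * (X zero (suc j) * D i j)))
    rowFirst j i = sgn (suc (toℕ j)) * (X zero (suc j) * (sgn (toℕ i) * (X (suc i) zero * D i j)))

    expanded : Vector Carrier (suc k)
    expanded j = sgn (suc (toℕ j)) * (X zero (suc j) * det R (λ a b → X (suc a) (punchIn (suc j) b)))

    distribute : ∀ m x {d} (f : Vector Carrier (suc k)) → d ≈ sum f →
                 sgn (suc m) * (x * d) ≈ sum (λ i → sgn (suc m) * (x * f i))
    distribute m x f d≈ = trans (*-congˡ (trans (*-congˡ d≈) (*-distribˡ-sum x f)))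
      (*-distribˡ-sum (sgn (suc m)) (λ i → x * f i))

  -- In the expansion along the top row the first two terms have equal cofactors and opposite signs;
  -- every other cofactor again has equal first columns and vanishes by induction.
  det-equal-first-columns : ∀ {k} {X : Matrix R (suc (suc k)) (suc (suc k))} →
    (∀ a → X a zero ≈ X a (suc zero)) → det R X ≈ 0#
  det-equal-first-columns {k} {X} eq = begin
    det R X
      ≈⟨ det-expand-row X ⟩
    1# * (X zero zero * D₀) + (- 1# * 1# * (X zero (suc zero) * D₁) + sum rest)
      ≈⟨ +-congˡ (+-cong (*-congˡ (*-cong (sym (eq zero)) D₁≈D₀)) (sum-zero rest rest≈0)) ⟩
    1# * (X zero zero * D₀) + (- 1# * 1# * (X zero zero * D₀) + 0#)
      ≈⟨ solve 2 (λ m y → con 1 :* y :+ (m :* con 1 :* y :+ con 0) := (con 1 :+ m) :* y) refl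
           (- 1#) (X zero zero * D₀) ⟩
    (1# - 1#) * (X zero zero * D₀)
      ≈⟨ trans (*-congʳ (-‿inverseʳ 1#)) (zeroˡ _) ⟩
    0# ∎
    where
    cofactor : Fin (suc (suc k)) → Matrix R (suc k) (suc k)
    cofactor j a b = X (suc a) (punchIn j b)

    D₀ D₁ : Carrier
    D₀ = det R (cofactor zero)
    D₁ = det R (cofactor (suc zero))

    D₁≈D₀ : D₁ ≈ D₀
    D₁≈D₀ = det-cong {X = cofactor (suc zero)} {cofactor zero} λ { a zero → eq (suc a) ; a (suc b) → refl }

    rest : Vector Carrier k
    rest j = sgn (toℕ (suc (suc j))) * (X zero (suc (suc j)) * det R (cofactor (suc (suc j))))

    -- Stated for all k so that k can be matched on: for k = 0 there is no j.
    cofactor≈0 : ∀ {k} {X : Matrix R (suc (suc k)) (suc (suc k))} → (∀ a → X a zero ≈ X a (suc zero)) →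
      (j : Fin k) → det R (λ a b → X (suc a) (punchIn (suc (suc j)) b)) ≈ 0#
    cofactor≈0 {suc k} {X} eq j =
      det-equal-first-columns {X = λ a b → X (suc a) (punchIn (suc (suc j)) b)} λ a → eq (suc a)

    rest≈0 : ∀ j → rest j ≈ 0#
    rest≈0 j = trans (*-congˡ (trans (*-congˡ (cofactor≈0 {X = X} eq j)) (zeroʳ _))) (zeroʳ _)

  -- Expansion along the first column leaves both equal columns in every minor.
  det-equal-later-columns : ∀ {k} {i j : Fin k} →
    (∀ {X} → (∀ a → X a i ≈ X a j) → det R X ≈ 0#) →
    ∀ {X} → (∀ a → X a (suc i) ≈ X a (suc j)) → det R X ≈ 0#
  det-equal-later-columns vanish {X} eq = sum-zero (laplaceTerm X) λ l →
    trans (*-congˡ {sgn (toℕ l)} (trans (*-congˡ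
      (vanish {minor X l} λ a → eq (punchIn l a))) (zeroʳ _))) (zeroʳ _)

  -- Exchange column `suc zero` with the column that equals column zero, so that the equal columns
  -- become the first two. The exchange needs vanishing for that pair of later columns, which passes
  -- to minors and there is an instance with a smaller j.
  det-equal-zeroth-column : ∀ {k} (j : Fin k) {X} → (∀ a → X a zero ≈ X a (suc j)) → det R X ≈ 0#
  det-equal-zeroth-column zero    {X} eq = det-equal-first-columns {X = X} eq
  det-equal-zeroth-column (suc j) {X} eq = begin
    det R X            ≈⟨ +-identityʳ _ ⟨
    det R X + 0#       ≈⟨ +-congˡ (det-equal-first-columns {X = Y} eq) ⟨
    det R X + det R Y  ≈⟨ exchange-columns det-isMultilinear {suc zero} {suc (suc j)} (λ ())
                            (λ {Z} → det-equal-later-columns (λ {Z′} → det-equal-zeroth-column j {Z′}) {Z})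
                            {X} {Y} (λ a → refl) (setCol-at Y₁ (suc (suc j)) x₁)
                            (λ a b b≢1 b≢j → trans (setCol-off Y₁ (suc (suc j)) x₁ a b b≢j)
                                                   (setCol-off X (suc zero) xⱼ a b b≢1)) ⟩
    0# ∎
    where
    x₁ xⱼ : Vector Carrier _
    x₁ a = X a (suc zero)
    xⱼ a = X a (suc (suc j))

    Y₁ Y : Matrix R _ _
    Y₁ = setCol X (suc zero) xⱼ
    Y = setCol Y₁ (suc (suc j)) x₁

  det-alternating : ∀ {k} {i j : Fin k} → i ≢ j → ∀ {X} → (∀ a → X a i ≈ X a j) → det R X ≈ 0#
  det-alternating {i = zero}  {zero}  i≢j     eq = contradiction ≡.refl i≢j
  det-alternating {i = zero}  {suc j} i≢j {X} eq = det-equal-zeroth-column j {X} eq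
  det-alternating {i = suc i} {zero}  i≢j {X} eq = det-equal-zeroth-column i {X} (sym ∘ eq)
  det-alternating {i = suc i} {suc j} i≢j {X} eq = det-equal-later-columns
    (λ {Y} → det-alternating (i≢j ∘ ≡.cong suc) {Y}) {X} eq

  det-isAlternating : ∀ {k} → IsAlternating (det R {k})
  det-isAlternating = record
    { isMultilinear = det-isMultilinear
    ; alternating   = λ i≢j {X} → det-alternating i≢j {X}
    }

-- Cullis' determinant as a nonzero alternating form.

module CullisDeterminant {c ℓ} (R : CommutativeRing c ℓ) where

  open CommutativeRing R hiding (zero)
  open AlternatingForms R
  open import Algebra.Properties.Semiring.Sum semiring using (sum)
  open import Algebra.Solver.Ring.NaturalCoefficients.Default commutativeSemiring
    using (solve; _:+_; _:*_; _:=_)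
  open import Relation.Binary.Reasoning.Setoid setoid

  module _ {n k : ℕ} where

    0-isAlternating : IsAlternating {n} {k} (const 0#)
    0-isAlternating = record
      { isMultilinear = record
        { ω-cong = λ _ → refl
        ; linear = λ _ s t _ _ _ → sym (trans (+-cong (zeroʳ s) (zeroʳ t)) (+-identityˡ 0#))
        }
      ; alternating = λ _ _ → refl
      }

    +-isAlternating : ∀ {ω₁ ω₂ : Matrix R n k → Carrier} → IsAlternating ω₁ → IsAlternating ω₂ →
                      IsAlternating (λ X → ω₁ X + ω₂ X)
    +-isAlternating {ω₁} {ω₂} alt₁ alt₂ = record
      { isMultilinear = record
        { ω-cong = λ eq → +-cong (A.ω-cong eq) (B.ω-cong eq)
        ; linear = λ j s t {X} {Y} {Z} eq offY offZ → trans
            (+-cong (A.linear j s t eq offY offZ) (B.linear j s t eq offY offZ))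
            (solve 6 (λ s t p q p′ q′ → (s :* p :+ t :* q) :+ (s :* p′ :+ t :* q′)
              := s :* (p :+ p′) :+ t :* (q :+ q′)) refl s t (ω₁ Y) (ω₁ Z) (ω₂ Y) (ω₂ Z))
        }
      ; alternating = λ i≢j eq →
          trans (+-cong (A.alternating i≢j eq) (B.alternating i≢j eq)) (+-identityˡ 0#)
      }
      where
      module A = IsAlternating alt₁
      module B = IsAlternating alt₂

    *-isAlternating : ∀ r {ω : Matrix R n k → Carrier} → IsAlternating ω →
                      IsAlternating (λ X → r * ω X)
    *-isAlternating r {ω} alt = record
      { isMultilinear = record
        { ω-cong = λ eq → *-congˡ (ω-cong eq)
        ; linear = λ j s t {X} {Y} {Z} eq offY offZ → trans (*-congˡ (linear j s t eq offY offZ))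
            (solve 5 (λ r s t p q → r :* (s :* p :+ t :* q) := s :* (r :* p) :+ t :* (r :* q))
              refl r s t (ω Y) (ω Z))
        }
      ; alternating = λ i≢j eq → trans (*-congˡ (alternating i≢j eq)) (zeroʳ r)
      }
      where open IsAlternating alt

    selectRows-isAlternating : ∀ {m} (rows : Fin m → Fin n) {ω : Matrix R m k → Carrier} →
                               IsAlternating ω → IsAlternating (λ X → ω (X ∘ rows))
    selectRows-isAlternating rows alt = record
      { isMultilinear = record
        { ω-cong = λ eq → ω-cong (eq ∘ rows)
        ; linear = λ j s t eq offY offZ → linear j s t (eq ∘ rows) (offY ∘ rows) (offZ ∘ rows)
        }
      ; alternating = λ i≢j eq → alternating i≢j (eq ∘ rows)
      }
      where open IsAlternating alt

  cullisTerm : ∀ {n k} → Matrix R n k → KSubset n k → Carrier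
  cullisTerm X c = sgn (shift c) * det R (X ∘ element c)

  -- Selecting rows preserves relations between columns, so every term is alternating. `go` takes an
  -- arbitrary list, since the tail of `kSubsets n k` is not of that form again.
  cullisDet-isAlternating : ∀ {n k} → IsAlternating (cullisDet R {n} {k})
  cullisDet-isAlternating {n} {k} = go (kSubsets n k)
    where
    go : ∀ cs → IsAlternating (λ X → List.foldr _+_ 0# (List.map (cullisTerm {n} {k} X) cs))
    go List.[]       = 0-isAlternating
    go (c List.∷ cs) = +-isAlternating
      (*-isAlternating (sgn (shift c)) (selectRows-isAlternating (element c) det-isAlternating)) (go cs)

  listSum : List Carrier → Carrier
  listSum = List.foldr _+_ 0#

  listSum-++ : ∀ xs ys → listSum (xs List.++ ys) ≈ listSum xs + listSum ys
  listSum-++ List.[]       ys = sym (+-identityˡ _)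
  listSum-++ (x List.∷ xs) ys = trans (+-congˡ (listSum-++ xs ys)) (sym (+-assoc _ _ _))

  listSum-map-cong : ∀ {a b} {A : Set a} {B : Set b} (g : A → B) {f : B → Carrier} {h : A → Carrier} →
    (∀ x → f (g x) ≈ h x) → ∀ xs → listSum (List.map f (List.map g xs)) ≈ listSum (List.map h xs)
  listSum-map-cong g eq List.[]       = refl
  listSum-map-cong g eq (x List.∷ xs) = +-cong (eq x) (listSum-map-cong g eq xs)

  listSum-map-zero : ∀ {a b} {A : Set a} {B : Set b} (g : A → B) {f : B → Carrier} →
    (∀ x → f (g x) ≈ 0#) → ∀ xs → listSum (List.map f (List.map g xs)) ≈ 0#
  listSum-map-zero g eq List.[]       = refl
  listSum-map-zero g eq (x List.∷ xs) =
    trans (+-cong (eq x) (listSum-map-zero g eq xs)) (+-identityˡ 0#)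

  -- For k ≤ n this is the identity matrix above zero rows. The only term of Cullis' determinant
  -- that survives at it is the one of the first k rows.
  eye : ∀ n k → Matrix R n k
  eye (suc n) (suc k) zero    zero    = 1#
  eye (suc n) (suc k) zero    (suc b) = 0#
  eye (suc n) (suc k) (suc a) zero    = 0#
  eye (suc n) (suc k) (suc a) (suc b) = eye n k a b

  -- Putting row zero in front leaves `shift` unchanged by computation, so the signs agree. The
  -- first column of the selected submatrix is 1 followed by zeros, so one Laplace term remains.
  cullisTerm-eye-inside : ∀ {n k} ((p , eq) : KSubset n k) →
    cullisTerm (eye (suc n) (suc k)) (inside Vec.∷ p , ≡.cong suc eq) ≈ cullisTerm (eye n k) (p , eq)
  cullisTerm-eye-inside {n} {k} (p , ≡.refl) = *-congˡ (begin
    det R Y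
      ≡⟨⟩
    1# * (1# * d) + sum (λ i → laplaceTerm Y (suc i))
      ≈⟨ +-cong (trans (*-identityˡ _) (*-identityˡ _))
           (sum-zero (λ i → laplaceTerm Y (suc i)) λ i → trans (*-congˡ (zeroˡ _)) (zeroʳ _)) ⟩
    d + 0#
      ≈⟨ +-identityʳ d ⟩
    d ∎)
    where
    Y : Matrix R (suc k) (suc k)
    Y = eye (suc n) (suc k) ∘ element (inside Vec.∷ p , ≡.refl)

    d : Carrier
    d = det R (eye n k ∘ element (p , ≡.refl))

  cullisTerm-eye-outside : ∀ {n k} ((p , eq) : KSubset n (suc k)) →
    cullisTerm (eye (suc n) (suc k)) (outside Vec.∷ p , eq) ≈ 0#
  cullisTerm-eye-outside {n} {k} (p , eq) = trans (*-congˡ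
    (sum-zero (laplaceTerm Y) λ i → trans (*-congˡ (trans (*-congʳ (first-column p eq i)) (zeroˡ _))) (zeroʳ _)))
    (zeroʳ _)
    where
    Y : Matrix R (suc k) (suc k)
    Y = eye (suc n) (suc k) ∘ element (outside Vec.∷ p , eq)

    -- `element` computes only once the cardinality equation is matched with `refl`.
    first-column : ∀ {m} p (eq : ∣ p ∣ ≡ m) i → eye (suc n) (suc k) (element (outside Vec.∷ p , eq) i) zero ≈ 0#
    first-column p ≡.refl i = refl

  -- Subsets that omit row zero select a zero first column and contribute nothing; the others
  -- reproduce the sum with one row and one column fewer.
  cullisDet-eye : ∀ {n k} → k ≤ n → cullisDet R (eye n k) ≈ 1#
  cullisDet-eye {zero}  {zero}  z≤n = trans (+-identityʳ _) (*-identityˡ 1#)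
  cullisDet-eye {suc n} {zero}  z≤n = trans
    (listSum-map-cong _ {cullisTerm (eye (suc n) zero)} {cullisTerm (eye n zero)} (λ _ → refl) (kSubsets n zero))
    (cullisDet-eye {n} z≤n)
  cullisDet-eye {suc n} {suc k} (s≤s k≤n) = begin
    listSum (List.map f (List.map addRow (kSubsets n k) List.++ List.map skipRow (kSubsets n (suc k))))
      ≡⟨ ≡.cong listSum (map-++ f (List.map addRow (kSubsets n k)) _) ⟩
    listSum (List.map f (List.map addRow (kSubsets n k)) List.++
             List.map f (List.map skipRow (kSubsets n (suc k))))
      ≈⟨ listSum-++ (List.map f (List.map addRow (kSubsets n k))) _ ⟩
    listSum (List.map f (List.map addRow (kSubsets n k))) +
    listSum (List.map f (List.map skipRow (kSubsets n (suc k))))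
      ≈⟨ +-cong (listSum-map-cong addRow cullisTerm-eye-inside (kSubsets n k))
                (listSum-map-zero skipRow cullisTerm-eye-outside (kSubsets n (suc k))) ⟩
    cullisDet R (eye n k) + 0#
      ≈⟨ +-identityʳ _ ⟩
    cullisDet R (eye n k)
      ≈⟨ cullisDet-eye k≤n ⟩
    1# ∎
    where
    f : KSubset (suc n) (suc k) → Carrier
    f = cullisTerm (eye (suc n) (suc k))

    addRow : KSubset n k → KSubset (suc n) (suc k)
    addRow (p , eq) = inside Vec.∷ p , ≡.cong suc eq

    skipRow : KSubset n (suc k) → KSubset (suc n) (suc k)
    skipRow (p , eq) = outside Vec.∷ p , eq

-- What the argument uses of a Heyting field, freed from apartness. Inverses up to double negation
-- suffice, because they are only used towards stable goals.
record IsStableField {c ℓ} (R : CommutativeRing c ℓ) : Set (c ⊔ ℓ) where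
  open CommutativeRing R
  field
    ≈-stable : ∀ {x y} → ¬ ¬ x ≈ y → x ≈ y
    inverse  : ∀ {x} → ¬ x ≈ 0# → ¬ ¬ ∃ λ y → y * x ≈ 1#
    1≉0      : ¬ 1# ≈ 0#

-- Linear algebra over a field with stable equality.

module StableField {c ℓ} {R : CommutativeRing c ℓ} (isStableField : IsStableField R) where

  open CommutativeRing R hiding (zero)
  open IsStableField isStableField
  open AlternatingForms R
  open import Algebra.Properties.Semiring.Sum semiring
    using (sum; sum-remove; ∑-distrib-+; ∑-comm; *-distribˡ-sum; *-distribʳ-sum)
  open import Algebra.Properties.Ring ring using (-1*x≈-x)
  open import Algebra.Properties.Group +-group using (inverseˡ-unique)
  open import Algebra.Solver.Ring.NaturalCoefficients.Default commutativeSemiring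
    using (solve; _:+_; _:*_; _:=_; con)
  open import Relation.Binary.Reasoning.Setoid setoid

  -- If no entry were invertible, each would be zero by stability. The index cannot be computed in
  -- general, hence the double negation.
  pivot : ∀ {k} (v : Vector Carrier k) → ¬ (∀ i → v i ≈ 0#) → ¬ ¬ ∃₂ λ i y → y * v i ≈ 1#
  pivot v v≉0 none = v≉0 λ i → ≈-stable λ vᵢ≉0 → inverse vᵢ≉0 λ (y , eq) → none (i , y , eq)

  cancel : ∀ {m v} x y → m + v ≈ 0# → x + (m + v) * y ≈ x
  cancel x y eq = trans (+-congˡ (trans (*-congʳ eq) (zeroˡ y))) (+-identityʳ x)

  LinearlyIndependent : ∀ {N m} → Vector (Vector Carrier m) N → Set (c ⊔ ℓ)
  LinearlyIndependent {N} f = ∀ (a : Vector Carrier N) → (∀ j → sum (λ i → a i * f i j) ≈ 0#) → ∀ i → a i ≈ 0#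

  -- Gaussian elimination. If coordinate zero vanishes on the whole family, drop it; otherwise use a
  -- pivot p to clear that coordinate from the other vectors and drop both. The alternative is not
  -- decidable, but the inequality is, so it may be proved by contradiction.
  linearlyIndependent⇒≤ : ∀ {N m} (f : Vector (Vector Carrier m) N) → LinearlyIndependent f → N ≤ m
  linearlyIndependent⇒≤ {zero}  {m}     f ind = z≤n
  linearlyIndependent⇒≤ {suc N} {zero}  f ind = contradiction (ind (const 1#) (λ ()) zero) 1≉0
  linearlyIndependent⇒≤ {suc N} {suc m} f ind = decidable-stable (suc N ≤? suc m) λ N≰m →
    pivot (λ i → f i zero)
      (λ f₀≈0 → N≰m (m≤n⇒m≤1+n (linearlyIndependent⇒≤ (λ i j → f i (suc j)) λ a eq →
        ind a λ { zero    → sum-zero (λ i → a i * f i zero) (λ i → trans (*-congˡ (f₀≈0 i)) (zeroʳ _))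
                ; (suc j) → eq j })))
      λ (p , y , y*f≈1) → N≰m (s≤s (linearlyIndependent⇒≤ (eliminate p y) (eliminate-ind p y y*f≈1)))
    where
    eliminate : Fin (suc N) → Carrier → Vector (Vector Carrier m) N
    eliminate p y l j = f (punchIn p l) (suc j) + - (f (punchIn p l) zero * y) * f p (suc j)

    module _ (p : Fin (suc N)) (y : Carrier) (y*f≈1 : y * f p zero ≈ 1#) where

      eliminate-ind : LinearlyIndependent (eliminate p y)
      eliminate-ind a eq l = trans (sym (reflexive (insertAt-punchIn a p aₚ l))) (ind a⁺ relation (punchIn p l))
        where
        S : Fin (suc m) → Carrier
        S j = sum (λ l → a l * f (punchIn p l) j)

        -- Elimination subtracts `f (punchIn p l) zero * y` times vector p from vector l; collecting
        -- these multiples turns a relation among the reduced vectors into one among the original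
        -- vectors.
        aₚ : Carrier
        aₚ = sum (λ l → a l * - (f (punchIn p l) zero * y))

        a⁺ : Vector Carrier (suc N)
        a⁺ = insertAt a p aₚ

        aₚ+S₀y≈0 : aₚ + S zero * y ≈ 0#
        aₚ+S₀y≈0 = begin
          aₚ + S zero * y
            ≈⟨ +-congˡ (*-distribʳ-sum y (λ l → a l * f (punchIn p l) zero)) ⟩
          aₚ + sum (λ l → a l * f (punchIn p l) zero * y)
            ≈⟨ ∑-distrib-+ (λ l → a l * - (f (punchIn p l) zero * y)) (λ l → a l * f (punchIn p l) zero * y) ⟨
          sum (λ l → a l * - (f (punchIn p l) zero * y) + a l * f (punchIn p l) zero * y)
            ≈⟨ sum-zero (λ l → a l * - (f (punchIn p l) zero * y) + a l * f (punchIn p l) zero * y) (λ l →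
                 trans (+-congˡ (*-assoc _ _ _)) (trans (sym (distribˡ _ _ _))
                   (trans (*-congˡ (-‿inverseˡ _)) (zeroʳ _)))) ⟩
          0# ∎

        split : ∀ j → sum (λ i → a⁺ i * f i j) ≈ aₚ * f p j + S j
        split j = trans (sum-remove {i = p} (λ i → a⁺ i * f i j))
          (+-cong (*-congʳ (reflexive (insertAt-lookup a p aₚ)))
            (sum-cong (λ l → a⁺ (punchIn p l) * f (punchIn p l) j) (λ l → a l * f (punchIn p l) j)
              (λ l → *-congʳ (reflexive (insertAt-punchIn a p aₚ l)))))

        relation : ∀ j → sum (λ i → a⁺ i * f i j) ≈ 0#
        -- Elimination dropped this coordinate; here the relation holds by the choice of `aₚ` and
        -- the fact that y inverts the pivot.
        relation zero = begin
          sum (λ i → a⁺ i * f i zero)                   ≈⟨ split zero ⟩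
          aₚ * f p zero + S zero                        ≈⟨ +-congˡ (*-identityʳ _) ⟨
          aₚ * f p zero + S zero * 1#                   ≈⟨ +-congˡ (*-congˡ y*f≈1) ⟨
          aₚ * f p zero + S zero * (y * f p zero)       ≈⟨ +-congˡ (*-assoc _ _ _) ⟨
          aₚ * f p zero + S zero * y * f p zero         ≈⟨ distribʳ _ _ _ ⟨
          (aₚ + S zero * y) * f p zero                  ≈⟨ *-congʳ aₚ+S₀y≈0 ⟩
          0# * f p zero                                 ≈⟨ zeroˡ _ ⟩
          0#                                            ∎
        relation (suc j) = begin
          sum (λ i → a⁺ i * f i (suc j))
            ≈⟨ split (suc j) ⟩
          aₚ * f p (suc j) + S (suc j)
            ≈⟨ +-comm _ _ ⟩
          S (suc j) + aₚ * f p (suc j)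
            ≈⟨ +-congˡ (*-distribʳ-sum (f p (suc j)) (λ l → a l * - (f (punchIn p l) zero * y))) ⟩
          S (suc j) + sum (λ l → a l * - (f (punchIn p l) zero * y) * f p (suc j))
            ≈⟨ ∑-distrib-+ (λ l → a l * f (punchIn p l) (suc j))
                 (λ l → a l * - (f (punchIn p l) zero * y) * f p (suc j)) ⟨
          sum (λ l → a l * f (punchIn p l) (suc j) + a l * - (f (punchIn p l) zero * y) * f p (suc j))
            ≈⟨ sum-cong (λ l → a l * f (punchIn p l) (suc j) + a l * - (f (punchIn p l) zero * y) * f p (suc j))
                 (λ l → a l * eliminate p y l j)
                 (λ l → trans (+-congˡ (*-assoc _ _ _)) (sym (distribˡ _ _ _))) ⟩
          sum (λ l → a l * eliminate p y l j)
            ≈⟨ eq j ⟩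
          0# ∎

  -- Matrices, rank-one matrices and independence modulo a subspace.

  infixl 6 _⊕_
  _⊕_ : ∀ {n k} → Matrix R n k → Matrix R n k → Matrix R n k
  (X ⊕ Y) a b = X a b + Y a b

  infixl 7 _⊗_
  _⊗_ : ∀ {n k} → Vector Carrier n → Vector Carrier k → Matrix R n k
  (x ⊗ v) a b = x a * v b

  Combination : ∀ {n k d} → Vector Carrier d → Vector (Matrix R n k) d → Matrix R n k
  Combination {n} {k} = combination (matrixSpace R n k)

  Combination-entry : ∀ {n k d} (t : Vector Carrier d) (u : Vector (Matrix R n k) d) a b →
                      Combination t u a b ≡ sum (λ i → t i * u i a b)
  Combination-entry {d = zero}  t u a b = ≡.refl
  Combination-entry {d = suc d} t u a b =
    ≡.cong (t zero * u zero a b +_) (Combination-entry (t ∘ suc) (u ∘ suc) a b)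

  -- The matrices represent linearly independent classes in the quotient by V, which is never
  -- formed.
  IndependentModulo : ∀ {n k d p} → Pred (Matrix R n k) p → Vector (Matrix R n k) d → Set (c ⊔ ℓ ⊔ p)
  IndependentModulo {d = d} V u = ∀ (t : Vector Carrier d) → Combination t u ∈ V → ∀ i → t i ≈ 0#

  Subspace : ∀ {n k p} → Pred (Matrix R n k) p → Set (c ⊔ ℓ ⊔ p)
  Subspace {n} {k} = IsSubspace (matrixSpace R n k)

  unit : ∀ {k} → Fin k → Vector Carrier k
  unit i = updateAt (const 0#) i (const 1#)

  unit-at : ∀ {k} (i : Fin k) → unit i i ≈ 1#
  unit-at i = reflexive (updateAt-updates i (const 0#))

  unit-off : ∀ {k} (i b : Fin k) → b ≢ i → unit i b ≈ 0#
  unit-off i b b≢i = reflexive (updateAt-minimal b i (const 0#) b≢i)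

  Combination-⊗-unit : ∀ {n k} (e : Vector Carrier n) (t : Vector Carrier k) →
                       Combination t (λ i → e ⊗ unit i) ≋ e ⊗ t
  Combination-⊗-unit {k = suc k} e t a b = begin
    Combination t (λ i → e ⊗ unit i) a b
      ≡⟨ Combination-entry t (λ i → e ⊗ unit i) a b ⟩
    sum (λ i → t i * (e a * unit i b))
      ≈⟨ sum-remove {i = b} (λ i → t i * (e a * unit i b)) ⟩
    t b * (e a * unit b b) + sum (λ i → t (punchIn b i) * (e a * unit (punchIn b i) b))
      ≈⟨ +-cong (*-congˡ (trans (*-congˡ (unit-at b)) (*-identityʳ _)))
           (sum-zero (λ i → t (punchIn b i) * (e a * unit (punchIn b i) b)) λ i →
             trans (*-congˡ (trans (*-congˡ (unit-off (punchIn b i) b (punchInᵢ≢i b i ∘ ≡.sym))) (zeroʳ _)))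
                   (zeroʳ _)) ⟩
    t b * e a + 0#
      ≈⟨ trans (+-identityʳ _) (*-comm _ _) ⟩
    e a * t b ∎

  -- A matrix is viewed as a vector of columns and filled in from zero one column at a time; each
  -- replacement adds some `x ⊗ unit i`.
  spanned-by-columns : ∀ {n k p} {V : Pred (Matrix R n k) p} → Subspace V →
                       (∀ x i → x ⊗ unit i ∈ V) → ∀ X → X ∈ V
  spanned-by-columns {V = V} sub col X = change-coordinates (λ cols → (λ a b → cols b a) ∈ V)
    (λ eq → resp λ a b → reflexive (≡.cong (λ col → col a) (eq b)))
    (λ i {x} {y} eq → λ x∈V → resp (λ a b → adjust i x y eq a b)
       (+-closed x∈V (col (λ a → y i a - x i a) i)))
    (λ _ _ → 0#) (λ b a → X a b) 0-closed
    where
    open IsSubspace sub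

    adjust : ∀ i (x y : Fin _ → Vector Carrier _) → (∀ b → b ≢ i → x b ≡ y b) →
             ∀ a b → x b a + (y i a - x i a) * unit i b ≈ y b a
    adjust i x y eq a b with b ≟ i
    ... | yes ≡.refl = begin
      x b a + (y b a - x b a) * unit b b  ≈⟨ +-congˡ (trans (*-congˡ (unit-at b)) (*-identityʳ _)) ⟩
      x b a + (y b a - x b a)             ≈⟨ +-comm _ _ ⟩
      y b a - x b a + x b a               ≈⟨ +-assoc _ _ _ ⟩
      y b a + (- x b a + x b a)           ≈⟨ trans (+-congˡ (-‿inverseˡ _)) (+-identityʳ _) ⟩
      y b a                               ∎
    ... | no b≢i = begin
      x b a + (y i a - x i a) * unit i b  ≈⟨ +-congˡ (trans (*-congˡ (unit-off i b b≢i)) (zeroʳ _)) ⟩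
      x b a + 0#                          ≈⟨ +-identityʳ _ ⟩
      x b a                               ≡⟨ ≡.cong (λ col → col a) (eq b b≢i) ⟩
      y b a                               ∎

  -- Induction on the number of columns.

  module Reduction {n k p} {ω : Matrix R n (suc k) → Carrier} (alt : IsAlternating ω)
    {V : Pred (Matrix R n (suc k)) p} (sub : Subspace V)
    (s : Matrix R n (suc k)) (vanish : ∀ X → X ∈ V → ω (s ⊕ X) ≈ 0#)
    (e : Vector Carrier n) (j : Fin (suc k)) (v : Vector Carrier (suc k)) (vⱼ≈1 : v j ≈ 1#)
    where

    open IsAlternating alt
    open IsSubspace sub

    v⁻ : Vector Carrier k
    v⁻ b = v (punchIn j b)

    -- The change of coordinates in which v becomes the unit vector at j, followed by deletion of
    -- column j.
    φ : Matrix R n (suc k) → Matrix R n k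
    φ X a b = X a (punchIn j b) + - v⁻ b * X a j

    φ-cong : ∀ {X Y} → X ≋ Y → φ X ≋ φ Y
    φ-cong eq a b = +-cong (eq a (punchIn j b)) (*-congˡ (eq a j))

    φ-⊗ : ∀ x → φ (x ⊗ v) ≋ λ _ _ → 0#
    φ-⊗ x a b = begin
      x a * v⁻ b + - v⁻ b * (x a * v j)  ≈⟨ +-congˡ (*-congˡ (trans (*-congˡ vⱼ≈1) (*-identityʳ _))) ⟩
      x a * v⁻ b + - v⁻ b * x a          ≈⟨ +-congʳ (*-comm _ _) ⟩
      v⁻ b * x a + - v⁻ b * x a          ≈⟨ distribʳ _ _ _ ⟨
      (v⁻ b - v⁻ b) * x a                ≈⟨ trans (*-congʳ (-‿inverseʳ _)) (zeroˡ _) ⟩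
      0#                                 ∎

    φ-⊕ : ∀ X Y → φ (X ⊕ Y) ≋ φ X ⊕ φ Y
    φ-⊕ X Y a b = solve 5 (λ x y m z w → (x :+ y) :+ m :* (z :+ w) := (x :+ m :* z) :+ (y :+ m :* w))
      refl (X a (punchIn j b)) (Y a (punchIn j b)) (- v⁻ b) (X a j) (Y a j)

    φ-scale : ∀ r X → φ (λ a b → r * X a b) ≋ λ a b → r * φ X a b
    φ-scale r X a b = solve 4 (λ r x m z → r :* x :+ m :* (r :* z) := r :* (x :+ m :* z))
      refl r (X a (punchIn j b)) (- v⁻ b) (X a j)

    -- V + e ⊗ F^(k+1) modulo the kernel {x ⊗ v} of φ, double-negated to make it stable.
    V′ : Pred (Matrix R n k) (c ⊔ ℓ ⊔ p)
    V′ Y = ¬ ¬ ∃₂ λ X u → X ∈ V × Y ≋ φ X ⊕ e ⊗ u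

    V′-subspace : Subspace V′
    V′-subspace = record
      { resp      = λ eq Y∈ ¬∃ → Y∈ λ (X , u , X∈V , Y≋) →
                      ¬∃ (X , u , X∈V , λ a b → trans (sym (eq a b)) (Y≋ a b))
      ; 0-closed  = λ ¬∃ → ¬∃ ((λ _ _ → 0#) , const 0# , 0-closed , λ a b →
                      solve 2 (λ m x → con 0 := (con 0 :+ m :* con 0) :+ x :* con 0) refl (- v⁻ b) (e a))
      ; +-closed  = λ Y∈ Z∈ ¬∃ → Y∈ λ (X₁ , u₁ , X₁∈V , Y≋) → Z∈ λ (X₂ , u₂ , X₂∈V , Z≋) →
                      ¬∃ (X₁ ⊕ X₂ , (λ b → u₁ b + u₂ b) , +-closed X₁∈V X₂∈V , λ a b → trans
                        (+-cong (Y≋ a b) (Z≋ a b)) (trans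
                        (solve 5 (λ p q e u w → (p :+ e :* u) :+ (q :+ e :* w) := (p :+ q) :+ e :* (u :+ w))
                          refl (φ X₁ a b) (φ X₂ a b) (e a) (u₁ b) (u₂ b))
                        (+-congʳ (sym (φ-⊕ X₁ X₂ a b)))))
      ; *ₗ-closed = λ r Y∈ ¬∃ → Y∈ λ (X , u , X∈V , Y≋) →
                      ¬∃ ((λ a b → r * X a b) , (λ b → r * u b) , *ₗ-closed r X∈V , λ a b → trans
                        (*-congˡ (Y≋ a b)) (trans
                        (solve 4 (λ r p e u → r :* (p :+ e :* u) := r :* p :+ e :* (r :* u))
                          refl r (φ X a b) (e a) (u b))
                        (+-congʳ (sym (φ-scale r X a b)))))
      }

    -- The column operations behind `φ` only add multiples of column j to the other columns.
    ω-unshear : ∀ X → ω X ≈ ω (insertCol (φ X) j (λ a → X a j))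
    ω-unshear X = trans
      (ω-cong (insertCol-unique (φ X ⊕ (λ a → X a j) ⊗ v⁻) j (λ a → X a j) (λ _ → refl) λ a b → sym (entry a b)))
      (shear-invariant alt j (φ X) (λ a → X a j) v⁻)
      where
      entry : ∀ a b → X a (punchIn j b) + - v⁻ b * X a j + X a j * v⁻ b ≈ X a (punchIn j b)
      entry a b = trans (solve 4 (λ x m z v → (x :+ m :* z) :+ z :* v := x :+ (m :+ v) :* z)
        refl (X a (punchIn j b)) (- v⁻ b) (X a j) (v⁻ b)) (cancel _ _ (-‿inverseˡ _))

    -- Moving along e ⊗ v changes only column j of the sheared matrix, by e.
    vanish′ : e ⊗ v ∈ V → ∀ Y → Y ∈ V′ → ω (insertCol (φ s ⊕ Y) j e) ≈ 0#
    vanish′ ev∈V Y Y∈ = ≈-stable λ ω≉0 → Y∈ λ (X , u , X∈V , Y≋) → ω≉0 (begin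
      ω (insertCol (φ s ⊕ Y) j e)
        ≈⟨ ω-cong (insertCol-cong j (λ a b → trans (+-congˡ (Y≋ a b)) (trans (sym (+-assoc _ _ _))
             (+-congʳ (sym (φ-⊕ s X a b))))) (λ _ → refl)) ⟩
      ω (insertCol (φ (s ⊕ X) ⊕ e ⊗ u) j e)
        -- Column j is e here, so the summand `e ⊗ u` only adds multiples of column j to the other
        -- columns.
        ≈⟨ shear-invariant alt j (φ (s ⊕ X)) e u ⟩
      ω (insertCol (φ (s ⊕ X)) j e)
        ≈⟨ +-identityˡ _ ⟨
      0# + ω (insertCol (φ (s ⊕ X)) j e)
        ≈⟨ +-congʳ (trans (sym (ω-unshear (s ⊕ X))) (vanish X X∈V)) ⟨
      ω (insertCol (φ (s ⊕ X)) j (λ a → (s ⊕ X) a j)) + ω (insertCol (φ (s ⊕ X)) j e)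
        ≈⟨ add-in-slot (φ (s ⊕ X)) (λ a → (s ⊕ X) a j) e ⟨
      ω (insertCol (φ (s ⊕ X)) j (λ a → (s ⊕ X) a j + e a))
        ≈⟨ ω-cong (insertCol-cong j (λ a b → sym (φ-moved X a b)) (λ a → sym (moved X a))) ⟩
      ω (insertCol (φ (s ⊕ (X ⊕ e ⊗ v))) j (λ a → (s ⊕ (X ⊕ e ⊗ v)) a j))
        ≈⟨ ω-unshear (s ⊕ (X ⊕ e ⊗ v)) ⟨
      ω (s ⊕ (X ⊕ e ⊗ v))
        ≈⟨ vanish (X ⊕ e ⊗ v) (+-closed X∈V ev∈V) ⟩
      0# ∎)
      where
      off : ∀ Z x y a b → b ≢ j → insertCol Z j x a b ≈ insertCol Z j y a b
      off Z x y a = punchIn-elim _ j (λ j≢j → contradiction ≡.refl j≢j)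
        (λ b _ → trans (insertCol-in Z j x a b) (sym (insertCol-in Z j y a b)))

      add-in-slot : ∀ Z x y → ω (insertCol Z j (λ a → x a + y a)) ≈ ω (insertCol Z j x) + ω (insertCol Z j y)
      add-in-slot Z x y = additive j
        (λ a → trans (insertCol-at Z j (λ a → x a + y a) a) (sym (+-cong (insertCol-at Z j x a) (insertCol-at Z j y a))))
        (off Z _ x) (off Z _ y)

      moved : ∀ X a → s a j + (X a j + e a * v j) ≈ (s a j + X a j) + e a
      moved X a = trans (sym (+-assoc _ _ _)) (+-congˡ (trans (*-congˡ vⱼ≈1) (*-identityʳ _)))

      φ-moved : ∀ X → φ (s ⊕ (X ⊕ e ⊗ v)) ≋ φ (s ⊕ X)
      φ-moved X a b = begin
        φ (s ⊕ (X ⊕ e ⊗ v)) a b        ≈⟨ φ-cong (λ a b → sym (+-assoc (s a b) (X a b) (e a * v b))) a b ⟩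
        φ (s ⊕ X ⊕ e ⊗ v) a b          ≈⟨ φ-⊕ (s ⊕ X) (e ⊗ v) a b ⟩
        φ (s ⊕ X) a b + φ (e ⊗ v) a b  ≈⟨ +-congˡ (φ-⊗ e a b) ⟩
        φ (s ⊕ X) a b + 0#             ≈⟨ +-identityʳ _ ⟩
        φ (s ⊕ X) a b                  ∎

    -- A section of `φ`: as column j is zero, `φ` subtracts nothing.
    ψ : Matrix R n k → Matrix R n (suc k)
    ψ Y = insertCol Y j (const 0#)

    φ-Combination-ψ : ∀ {d} t (y : Vector (Matrix R n k) d) → φ (Combination t (ψ ∘ y)) ≋ Combination t y
    φ-Combination-ψ t y a b = begin
      Combination t (ψ ∘ y) a (punchIn j b) + - v⁻ b * Combination t (ψ ∘ y) a j
        ≡⟨ ≡.cong₂ (λ p q → p + - v⁻ b * q) (Combination-entry t (ψ ∘ y) a (punchIn j b))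
                                            (Combination-entry t (ψ ∘ y) a j) ⟩
      sum (λ i → t i * ψ (y i) a (punchIn j b)) + - v⁻ b * sum (λ i → t i * ψ (y i) a j)
        ≈⟨ +-cong (sum-cong (λ i → t i * ψ (y i) a (punchIn j b)) (λ i → t i * y i a b)
                    (λ i → *-congˡ (insertCol-in (y i) j (const 0#) a b)))
                  (*-congˡ (sum-zero (λ i → t i * ψ (y i) a j)
                    (λ i → trans (*-congˡ (insertCol-at (y i) j (const 0#) a)) (zeroʳ _)))) ⟩
      sum (λ i → t i * y i a b) + - v⁻ b * 0#
        ≈⟨ trans (+-congˡ (zeroʳ _)) (+-identityʳ _) ⟩
      sum (λ i → t i * y i a b)
        ≡⟨ Combination-entry t y a b ⟨
      Combination t y a b ∎

    -- Let X be a combination in V, with coefficient `t zero` at w. Applying `φ` shows that the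
    -- remaining coefficients combine y to `φ X` minus a multiple of `e ⊗ u`, an element of `V′`, so
    -- they vanish; this is why `V′` includes all `e ⊗ u`. What remains is a multiple of w in V, and
    -- w is not in V.
    extend-independent : ∀ {d} w u → ¬ w ∈ V → φ w ≋ e ⊗ u →
      (y : Vector (Matrix R n k) d) → IndependentModulo V′ y → IndependentModulo V (w ∷ (ψ ∘ y))
    extend-independent w u w∉V φw y ind t t∈V = λ { zero → t₀≈0 ; (suc i) → tail≈0 i }
      where
      t⁻ : Vector Carrier _
      t⁻ = t ∘ suc

      X : Matrix R n (suc k)
      X = Combination t (w ∷ (ψ ∘ y))

      decompose : ∀ a b → Combination t⁻ y a b ≈ φ X a b + e a * (- t zero * u b)
      decompose a b = sym (begin
        φ X a b + e a * (- t zero * u b)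
          ≈⟨ +-congʳ (trans (φ-⊕ (λ a b → t zero * w a b) (Combination t⁻ (ψ ∘ y)) a b)
               (+-cong (trans (φ-scale (t zero) w a b) (*-congˡ (φw a b))) (φ-Combination-ψ t⁻ y a b))) ⟩
        t zero * (e a * u b) + Combination t⁻ y a b + e a * (- t zero * u b)
          ≈⟨ solve 5 (λ t e u y m → (t :* (e :* u) :+ y) :+ e :* (m :* u) := y :+ (m :+ t) :* (e :* u))
               refl (t zero) (e a) (u b) (Combination t⁻ y a b) (- t zero) ⟩
        Combination t⁻ y a b + (- t zero + t zero) * (e a * u b)
          ≈⟨ cancel _ _ (-‿inverseˡ _) ⟩
        Combination t⁻ y a b ∎)

      tail≈0 : ∀ i → t (suc i) ≈ 0#
      tail≈0 = ind t⁻ λ ¬∃ → ¬∃ (X , (λ b → - t zero * u b) , t∈V , decompose)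

      X≋t₀w : ∀ a b → X a b ≈ t zero * w a b
      X≋t₀w a b = trans (+-congˡ (trans (reflexive (Combination-entry t⁻ (ψ ∘ y) a b))
        (sum-zero (λ i → t⁻ i * ψ (y i) a b) (λ i → trans (*-congʳ (tail≈0 i)) (zeroˡ _))))) (+-identityʳ _)

      t₀≈0 : t zero ≈ 0#
      t₀≈0 = ≈-stable λ t₀≉0 → inverse t₀≉0 λ (r , r*t₀≈1) → w∉V (resp
        (λ a b → trans (*-congˡ (X≋t₀w a b)) (trans (sym (*-assoc _ _ _))
          (trans (*-congʳ r*t₀≈1) (*-identityˡ _))))
        (*ₗ-closed r t∈V))

  -- Induction on k, refuting `none`. Stability of V allows membership in V to be proved by
  -- contradiction as well; `V′` is double-negated to meet this condition in the recursive call.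
  exists-independentModulo : ∀ {n k p} {ω : Matrix R n k → Carrier} → IsAlternating ω →
    {V : Pred (Matrix R n k) p} → Subspace V → (∀ {X} → ¬ ¬ X ∈ V → X ∈ V) →
    ∀ s → (∀ X → X ∈ V → ω (s ⊕ X) ≈ 0#) → ∀ X₀ → ¬ ω X₀ ≈ 0# →
    ¬ ¬ ∃ λ (u : Vector (Matrix R n k) k) → IndependentModulo V u
  exists-independentModulo {k = zero} alt sub stable s vanish X₀ ωX₀≉0 none = none ([] , λ _ _ ())
  exists-independentModulo {n} {suc k} {ω = ω} alt {V} sub stable s vanish X₀ ωX₀≉0 none =
    -- Combinations of these matrices are of the form `e ⊗ t`, and `no-e⊗t`, itself derived from
    -- `none`, leaves only t = 0.
    none ((λ i → e ⊗ unit i) , λ t t∈V i → ≈-stable λ tᵢ≉0 →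
      no-e⊗t t (resp (Combination-⊗-unit e t) t∈V) λ t≈0 → tᵢ≉0 (t≈0 i))
    where
    open IsAlternating alt
    open IsSubspace sub

    e : Vector Carrier n
    e a = X₀ a zero

    -- The vector e comes from column zero of `X₀`, while the pivot j of v may be anywhere.
    nonzero-at-slot : ∀ j → ¬ ¬ ∃ λ Y → ¬ ω (insertCol Y j e) ≈ 0#
    nonzero-at-slot j ¬∃ = ωX₀≉0 (vanishes-at-every-slot alt j e
      (λ Y → ≈-stable λ ω≉0 → ¬∃ (Y , ω≉0)) zero X₀ (λ _ → refl))

    -- If w were outside V, the induction hypothesis for the contracted form would give k matrices
    -- independent modulo `V′`, and w would complete them to a family excluded by `none`.
    absorb : ∀ j v → (vⱼ≈1 : v j ≈ 1#) → e ⊗ v ∈ V → ∀ w u →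
             Reduction.φ alt sub s vanish e j v vⱼ≈1 w ≋ e ⊗ u → w ∈ V
    absorb j v vⱼ≈1 ev∈V w u φw = stable λ w∉V → nonzero-at-slot j λ (Y₀ , ω≉0) →
      exists-independentModulo (insertCol-isAlternating alt j e) V′-subspace
        (λ Y∈ ¬∃ → Y∈ λ Y∈′ → Y∈′ ¬∃) (φ s) (vanish′ ev∈V) Y₀ ω≉0
        λ (y , ind) → none (w ∷ (ψ ∘ y) , extend-independent w u w∉V φw y ind)
      where open Reduction alt sub s vanish e j v vⱼ≈1

    -- For the direction `e ⊗ v`, `φ` sends each `e ⊗ unit i` to some `e ⊗ u`, so all of these are
    -- absorbed. Each then serves as the direction itself, and its own `φ` kills `x ⊗ unit i` for
    -- every x.
    everything : ∀ j v → v j ≈ 1# → e ⊗ v ∈ V → ∀ X → X ∈ V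
    everything j v vⱼ≈1 ev∈V = spanned-by-columns sub λ x i →
      absorb i (unit i) (unit-at i) (e⊗unit∈V i) (x ⊗ unit i) (const 0#)
        λ a b → trans (Reduction.φ-⊗ alt sub s vanish e i (unit i) (unit-at i) x a b) (sym (zeroʳ _))
      where
      e⊗unit∈V : ∀ i → e ⊗ unit i ∈ V
      e⊗unit∈V i = absorb j v vⱼ≈1 ev∈V (e ⊗ unit i)
        (λ b → unit i (punchIn j b) + - v (punchIn j b) * unit i j)
        λ a b → solve 4 (λ e x m y → e :* x :+ m :* (e :* y) := e :* (x :+ m :* y)) refl
          (e a) (unit i (punchIn j b)) (- v (punchIn j b)) (unit i j)

    -- Scaling by the inverse of an invertible entry of t makes `everything` applicable. Then V
    -- contains `X₀` minus s, and ω vanishes at `X₀`.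
    no-e⊗t : ∀ t → e ⊗ t ∈ V → ¬ ¬ (∀ i → t i ≈ 0#)
    no-e⊗t t et∈V t≉0 = pivot t t≉0 λ (j , r , r*tⱼ≈1) → ωX₀≉0 (begin
      ω X₀                        ≈⟨ ω-cong (λ a b → sym (restore (s a b) (X₀ a b))) ⟩
      ω (s ⊕ λ a b → X₀ a b - s a b)
        ≈⟨ vanish _ (everything j (λ b → r * t b) r*tⱼ≈1
             (resp (λ a b → solve 3 (λ r e t → r :* (e :* t) := e :* (r :* t)) refl r (e a) (t b))
               (*ₗ-closed r et∈V)) _) ⟩
      0#                          ∎)
      where
      restore : ∀ x y → x + (y - x) ≈ y
      restore x y = trans (+-comm _ _) (trans (+-assoc _ _ _) (trans (+-congˡ (-‿inverseˡ x)) (+-identityʳ y)))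

  -- From independence modulo the direction to the codimension.

  ↑-elim : ∀ {p} m {d} (P : Fin (m ℕ.+ d) → Set p) →
           (∀ i → P (i ↑ˡ d)) → (∀ i → P (m ↑ʳ i)) → ∀ i → P i
  ↑-elim zero    P left right i       = right i
  ↑-elim (suc m) P left right zero    = left zero
  ↑-elim (suc m) P left right (suc i) = ↑-elim m (P ∘ suc) (left ∘ suc) right i

  sum-split : ∀ m {d} (f : Vector Carrier (m ℕ.+ d)) →
              sum f ≈ sum (λ i → f (i ↑ˡ d)) + sum (λ i → f (m ↑ʳ i))
  sum-split zero    f = sym (+-identityˡ _)
  sum-split (suc m) f = trans (+-congˡ (sum-split m (f ∘ suc))) (sym (+-assoc _ _ _))

  module _ {n k : ℕ} where

    Independent : ∀ {d} → Vector (Matrix R n k) d → Set (c ⊔ ℓ)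
    Independent {d} w = ∀ (t : Vector Carrier d) → Combination t w ≋ (λ _ _ → 0#) → ∀ i → t i ≈ 0#

    -- Pass to coordinates with respect to B: a relation among the coordinate vectors is a relation
    -- among the matrices, so the bound in coordinate space applies.
    independent⇒≤ : ∀ {N m} {B : Vector (Matrix R n k) m} → IsBasis (matrixSpace R n k) U B →
                    (w : Vector (Matrix R n k) N) → Independent w → N ≤ m
    independent⇒≤ {N} {m} {B} B-basis w ind = linearlyIndependent⇒≤ f λ t eq → ind t λ a b → begin
      Combination t w a b
        ≡⟨ Combination-entry t w a b ⟩
      sum (λ i → t i * w i a b)
        ≈⟨ sum-cong (λ i → t i * w i a b) (λ i → sum (λ j → t i * f i j * B j a b)) (λ i → expand t a b i) ⟩
      sum (λ i → sum (λ j → t i * f i j * B j a b))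
        ≈⟨ ∑-comm (λ i j → t i * f i j * B j a b) ⟩
      sum (λ j → sum (λ i → t i * f i j * B j a b))
        ≈⟨ sum-zero (λ j → sum (λ i → t i * f i j * B j a b)) (λ j →
             trans (sym (*-distribʳ-sum (B j a b) (λ i → t i * f i j))) (trans (*-congʳ (eq j)) (zeroˡ _))) ⟩
      0# ∎
      where
      open IsBasis B-basis

      f : Vector (Vector Carrier m) N
      f i = proj₁ (spanning {w i} _)

      expand : ∀ t a b i → t i * w i a b ≈ sum (λ j → t i * f i j * B j a b)
      expand t a b i = begin
        t i * w i a b
          ≈⟨ *-congˡ (proj₂ (spanning {w i} _) a b) ⟩
        t i * Combination (f i) B a b
          ≡⟨ ≡.cong (t i *_) (Combination-entry (f i) B a b) ⟩
        t i * sum (λ j → f i j * B j a b)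
          ≈⟨ *-distribˡ-sum (t i) (λ j → f i j * B j a b) ⟩
        sum (λ j → t i * (f i j * B j a b))
          ≈⟨ sum-cong (λ j → t i * (f i j * B j a b)) (λ j → t i * f i j * B j a b) (λ j → sym (*-assoc _ _ _)) ⟩
        sum (λ j → t i * f i j * B j a b) ∎

    Combination-closed : ∀ {d p} {V : Pred (Matrix R n k) p} → Subspace V →
      (t : Vector Carrier d) (u : Vector (Matrix R n k) d) → (∀ i → u i ∈ V) → Combination t u ∈ V
    Combination-closed {zero}  sub t u u∈V = IsSubspace.0-closed sub
    Combination-closed {suc d} sub t u u∈V = IsSubspace.+-closed sub
      (IsSubspace.*ₗ-closed sub (t zero) (u∈V zero)) (Combination-closed sub (t ∘ suc) (u ∘ suc) (u∈V ∘ suc))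

    Combination-++ : ∀ {m d} (t : Vector Carrier (m ℕ.+ d))
      (u : Vector (Matrix R n k) m) (w : Vector (Matrix R n k) d) →
      Combination t (u ++ w) ≋ Combination (λ i → t (i ↑ˡ d)) u ⊕ Combination (λ i → t (m ↑ʳ i)) w
    Combination-++ {m} {d} t u w a b = begin
      Combination t (u ++ w) a b
        ≡⟨ Combination-entry t (u ++ w) a b ⟩
      sum (λ i → t i * (u ++ w) i a b)
        ≈⟨ sum-split m (λ i → t i * (u ++ w) i a b) ⟩
      sum (λ i → t (i ↑ˡ d) * (u ++ w) (i ↑ˡ d) a b) + sum (λ i → t (m ↑ʳ i) * (u ++ w) (m ↑ʳ i) a b)
        ≈⟨ +-cong
             (sum-cong (λ i → t (i ↑ˡ d) * (u ++ w) (i ↑ˡ d) a b) (λ i → t (i ↑ˡ d) * u i a b)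
               (λ i → reflexive (≡.cong (λ X → t (i ↑ˡ d) * X a b) (lookup-++ˡ u w i))))
             (sum-cong (λ i → t (m ↑ʳ i) * (u ++ w) (m ↑ʳ i) a b) (λ i → t (m ↑ʳ i) * w i a b)
               (λ i → reflexive (≡.cong (λ X → t (m ↑ʳ i) * X a b) (lookup-++ʳ u w i)))) ⟩
      sum (λ i → t (i ↑ˡ d) * u i a b) + sum (λ i → t (m ↑ʳ i) * w i a b)
        ≡⟨ ≡.cong₂ _+_ (Combination-entry (λ i → t (i ↑ˡ d)) u a b)
                       (Combination-entry (λ i → t (m ↑ʳ i)) w a b) ⟨
      (Combination (λ i → t (i ↑ˡ d)) u ⊕ Combination (λ i → t (m ↑ʳ i)) w) a b ∎

    -- In a vanishing combination the part in u is the negative of an element of V, so its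
    -- coefficients vanish; then those of the basis w do.
    ++-independent : ∀ {m d p} {V : Pred (Matrix R n k) p} → Subspace V →
      (u : Vector (Matrix R n k) m) → IndependentModulo V u →
      {w : Vector (Matrix R n k) d} → IsBasis (matrixSpace R n k) V w → Independent (u ++ w)
    ++-independent {m} {d} {V = V} sub u u-ind {w} w-basis t eq =
      ↑-elim m (λ i → t i ≈ 0#) t₁≈0 (independent t₂ λ a b → begin
        Combination t₂ w a b
          ≈⟨ +-identityˡ _ ⟨
        0# + Combination t₂ w a b
          ≈⟨ +-congʳ (trans (reflexive (Combination-entry t₁ u a b))
               (sum-zero (λ i → t₁ i * u i a b) (λ i → trans (*-congʳ (t₁≈0 i)) (zeroˡ _)))) ⟨
        Combination t₁ u a b + Combination t₂ w a b
          ≈⟨ sum≈0 a b ⟩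
        0# ∎)
      where
      open IsSubspace sub
      open IsBasis w-basis

      t₁ : Vector Carrier m
      t₁ i = t (i ↑ˡ d)

      t₂ : Vector Carrier d
      t₂ i = t (m ↑ʳ i)

      sum≈0 : Combination t₁ u ⊕ Combination t₂ w ≋ λ _ _ → 0#
      sum≈0 a b = trans (sym (Combination-++ t u w a b)) (eq a b)

      t₁≈0 : ∀ i → t₁ i ≈ 0#
      t₁≈0 = u-ind t₁ (resp
        (λ a b → trans (-1*x≈-x _) (sym (inverseˡ-unique _ _ (sum≈0 a b))))
        (*ₗ-closed (- 1#) (Combination-closed sub t₂ w members)))

  -- The k matrices together with a basis of the direction give k + dimV ≤ dimW. The direction need
  -- not be stable, so its double negation is used: ω still vanishes along it because equality is
  -- stable, and independence modulo it implies independence modulo the direction.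
  codim-lower-bound : ∀ {n k p q} {ω : Matrix R n k → Carrier} → IsAlternating ω →
    ∀ X₀ → ¬ ω X₀ ≈ 0# →
    {K : Pred (Matrix R n k) q} (K-variety : IsLinearVariety (matrixSpace R n k) p K) →
    (∀ X → X ∈ K → ω X ≈ 0#) →
    ∀ codim → HasCodim (matrixSpace R n k) K-variety codim → k ≤ codim
  codim-lower-bound {n} {k} {ω = ω} alt X₀ ωX₀≉0 K-variety vanish _
    (dimW , dimV , (_ , W-basis) , (_ , V-basis) , ≡.refl) =
    decidable-stable (k ≤? dimW ℕ.∸ dimV) λ k≰codim →
      exists-independentModulo alt ¬¬V-subspace (λ ¬¬¬¬V ¬V → ¬¬¬¬V λ ¬¬V → ¬¬V ¬V)
        point (λ X ¬¬V → ≈-stable λ ω≉0 → ¬¬V λ X∈V →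
          ω≉0 (vanish _ (Equivalence.from (translate _) (X , X∈V , λ _ _ → refl))))
        X₀ ωX₀≉0
        λ (u , u-ind) → k≰codim (m+n≤o⇒m≤o∸n k
          (independent⇒≤ W-basis _ (++-independent isSubspace u
            (λ t t∈V → u-ind t λ ¬V → ¬V t∈V) V-basis)))
    where
    open IsLinearVariety K-variety
    open IsSubspace isSubspace

    ¬¬V-subspace : Subspace (λ X → ¬ ¬ X ∈ direction)
    ¬¬V-subspace = record
      { resp      = λ eq ¬¬V ¬V → ¬¬V (¬V ∘ resp eq)
      ; 0-closed  = λ ¬V → ¬V 0-closed
      ; +-closed  = λ ¬¬X ¬¬Y ¬V → ¬¬X λ X∈V → ¬¬Y λ Y∈V → ¬V (+-closed X∈V Y∈V)
      ; *ₗ-closed = λ r ¬¬V ¬V → ¬¬V (¬V ∘ *ₗ-closed r)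
      }

-- Heyting fields and the codimension bound for Cullis' determinant.

heytingField-isStableField : ∀ {c ℓ₁ ℓ₂} (F : HeytingField c ℓ₁ ℓ₂) → IsStableField (commutativeRing F)
heytingField-isStableField F = record { ≈-stable = ≈-stable ; inverse = inverse ; 1≉0 = 1≉0 }
  where
  open HeytingField F
  open import Algebra.Properties.Ring (CommutativeRing.ring (commutativeRing F)) using (-0#≈0#)

  ≈-stable : ∀ {x y} → ¬ ¬ x ≈ y → x ≈ y
  -- By tightness equality is the negation of apartness, and negations are stable.
  ≈-stable {x} {y} ¬¬x≈y = proj₁ (tight x y) λ x#y → ¬¬x≈y λ x≈y → #-irrefl x≈y x#y

  x-0≈x : ∀ x → x - 0# ≈ x
  x-0≈x x = trans (+-congˡ -0#≈0#) (+-identityʳ x)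

  inverse : ∀ {x} → ¬ x ≈ 0# → ¬ ¬ ∃ λ y → y * x ≈ 1#
  -- Without an inverse, x cannot be apart from zero, so it is zero by tightness. Invertibility is
  -- supplied for the difference of x and zero, hence `x-0≈x`.
  inverse {x} x≉0 none = x≉0 (proj₁ (tight x 0#) λ x#0 →
    let y , y*x≈1 , _ = #⇒invertible x#0
    in none (y , trans (*-congˡ (sym (x-0≈x x))) y*x≈1))

  -- If 1 ≈ 0, then 0 is invertible, so 0 # 0.
  1≉0 : ¬ 1# ≈ 0#
  1≉0 1≈0 = #-irrefl refl (invertible⇒# {0#} {0#}
    (0# , trans (zeroˡ _) (sym 1≈0) , trans (zeroʳ _) (sym 1≈0)))

mainTheorem2 : ∀ {c ℓ₁ ℓ₂ p q} (F : HeytingField c ℓ₁ ℓ₂) →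
    let open HeytingField F using (_≈_)
        open HeytingField F using (0#)
        R = commutativeRing F
    in (n k : ℕ) → 1 ≤ k → k ≤ n →
       (K : Pred (Matrix R n k) q) (K-variety : IsLinearVariety (matrixSpace R n k) p K) →
       (∀ X → X ∈ K → cullisDet R X ≈ 0#) →
       ∀ codim → HasCodim (matrixSpace R n k) K-variety codim → k ≤ codim
mainTheorem2 F n k _ k≤n K K-variety =
  -- `eye n k` is the point where the form is nonzero: its value there is 1 because k ≤ n.
  codim-lower-bound cullisDet-isAlternating (eye n k)
    (λ eye≈0 → 1≉0 (trans (sym (cullisDet-eye k≤n)) eye≈0)) K-variety
  where
  open HeytingField F using (trans; sym)
  open IsStableField (heytingField-isStableField F)
  open StableField (heytingField-isStableField F)
  open CullisDeterminant (commutativeRing F)
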